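{- Let $K$ be a field of characteristic $0$, let $n\ge 1$, and let $\mathbf{q}=(q_1,\dots,q_n)$ be formal variables subject only to $q_1q_2\cdots q_n=1$. Then the element \[ \mathbf{e}_n(\mathbf{q})=\sum_{\sigma\in S_n}\frac{\prod_{j\in D(\sigma)} q_{\sigma(1)}q_{\sigma(2)}\cdots q_{\sigma(j)}}{\prod_{i=1}^{n-1}\bigl(1-q_{\sigma(1)}q_{\sigma(2)}\cdots q_{\sigma(i)}\bigr)}\,\sigma \] of $K(\mathbf{q})S_n$ is a Lie element.
   Context: $K(\mathbf{q})$ denotes the field of rational functions over $K$ in $q_1,\dots,q_{n-1}$, with $q_n:=(q_1\cdots q_{n-1})^{ -1}$; in particular no product $q_{i_1}\cdots q_{i_r}$ over a nonempty proper subset $\{i_1,\dots,i_r\}\subsetneq\{1,\dots,n\}$ equals $1$. For a permutation $\sigma\in S_n$ written as the word $\sigma(1)\sigma(2)\cdots\sigma(n)$, its descent set is $D(\sigma)=\{i: 1\le i\le n-1,\ \sigma(i)>\sigma(i+1)\}$. $K(\mathbf{q})S_n$ is the vector space of $K(\mathbf{q})$-linear combinations of permutations of $S_n$, each permutation viewed as a word on the alphabet $X=\{1,\dots,n\}$, so that $K(\mathbf{q})S_n$ sits inside the free associative algebra $K(\mathbf{q})\langle X\rangle$ (product = concatenation of words). The Lie bracket is $[p,q]=pq-qp$, and the free Lie algebra $\mathcal{L}_{K(\mathbf{q})}(X)$ is the smallest subspace of $K(\mathbf{q})\langle X\rangle$ containing $X$ and closed under the bracket. A Lie element is an element of $K(\mathbf{q})S_n\cap\mathcal{L}_{K(\mathbf{q})}(X)$.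 -}

module Defs where

open import Level using (Level; _⊔_) renaming (suc to lsuc)
open import Algebra.Bundles using (CommutativeRing)
open import Data.Nat as ℕ using (ℕ; zero; suc)
open import Data.Fin as Fin using (Fin; inject₁; fromℕ)
open import Data.Vec as Vec using (Vec; tabulate; replicate; zipWith)
import Data.Vec.Properties as VecP
import Data.List.Properties as ListP
open import Data.List as List using (List; []; _∷_; _++_; [_]; map; concatMap; foldr; take; drop; upTo; allFin; filter; length)
open import Data.Product using (Σ; ∃; _×_; _,_; proj₁; proj₂)
open import Data.Bool using (Bool; true; false; if_then_else_)
open import Data.Empty using (⊥)
open import Relation.Nullary using (¬_; Dec; yes; no)
open import Relation.Nullary.Decidable using (⌊_⌋)
open import Relation.Binary.PropositionalEquality using (_≡_; _≢_) renaming (refl to ≡-refl)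

record Field (c ℓ : Level) : Set (lsuc (c ⊔ ℓ)) where
  field
    commutativeRing : CommutativeRing c ℓ
  open CommutativeRing commutativeRing public
  field
    1≉0     : ¬ (1# ≈ 0#)
    inverse : ∀ x → ¬ (x ≈ 0#) → ∃ λ y → x * y ≈ 1#

  natK : ℕ → Carrier
  natK zero    = 0#
  natK (suc k) = 1# + natK k

CharZero : ∀ {c ℓ} → Field c ℓ → Set ℓ
CharZero K = ∀ k → ¬ (natK (suc k) ≈ 0#)
  where open Field K

insertions : ∀ {a} {A : Set a} → A → List A → List (List A)
insertions x []       = [ x ∷ [] ]
insertions x (y ∷ ys) = (x ∷ y ∷ ys) ∷ map (y ∷_) (insertions x ys)

perms : ∀ {a} {A : Set a} → List A → List (List A)
perms []       = [ [] ]
perms (x ∷ xs) = concatMap (insertions x) (perms xs)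

-- the symmetric group S_n, as the list of words σ(1)σ(2)…σ(n) over Fin n
-- (letter i : Fin n stands for i+1 ∈ {1,…,n})
Sn : (n : ℕ) → List (List (Fin n))
Sn n = perms (allFin n)

-- j is a descent of the word w (1 ≤ j): w(j) > w(j+1)
descentAt : ∀ {n} → List (Fin n) → ℕ → Bool
descentAt w j = check (drop (j ℕ.∸ 1) w)
  where
  check : ∀ {n} → List (Fin n) → Bool
  check (x ∷ y ∷ _) = ⌊ y Fin.<? x ⌋
  check _           = false

module Over {c ℓ} (K : Field c ℓ) where
  open Field K

  -- Polynomials over K in m variables x_1..x_m, as finite formal sums of
  -- terms (coefficient , exponent vector); equality = equal coefficients.

  Exp : ℕ → Set
  Exp m = Vec ℕ m

  _≟e_ : ∀ {m} → (e f : Exp m) → Dec (e ≡ f)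
  _≟e_ = VecP.≡-dec ℕ._≟_

  Poly : ℕ → Set c
  Poly m = List (Carrier × Exp m)

  pcoeff : ∀ {m} → Poly m → Exp m → Carrier
  pcoeff [] e = 0#
  pcoeff ((k , f) ∷ p) e with f ≟e e
  ... | yes _ = k + pcoeff p e
  ... | no  _ = pcoeff p e

  _≈P_ : ∀ {m} → Poly m → Poly m → Set ℓ
  p ≈P q = ∀ e → pcoeff p e ≈ pcoeff q e

  0P : ∀ {m} → Poly m
  0P = []

  1P : ∀ {m} → Poly m
  1P = [ (1# , replicate _ 0) ]

  _+P_ : ∀ {m} → Poly m → Poly m → Poly m
  p +P q = p ++ q

  -P_ : ∀ {m} → Poly m → Poly m
  -P p = map (λ t → (- proj₁ t , proj₂ t)) p

  _*P_ : ∀ {m} → Poly m → Poly m → Poly m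
  p *P q = concatMap (λ t → map (λ u → (proj₁ t * proj₁ u , zipWith ℕ._+_ (proj₂ t) (proj₂ u))) q) p

  mono : ∀ {m} → Exp m → Poly m
  mono e = [ (1# , e) ]

  NZPoly : ℕ → Set (c ⊔ ℓ)
  NZPoly m = Σ (Poly m) (λ p → ¬ (p ≈P 0P))

  prodP : ∀ {m} → List (NZPoly m) → Poly m
  prodP = foldr (λ d acc → proj₁ d *P acc) 1P

  -- The rational function field K(x_1..x_m): fractions num / (d_1 ⋯ d_k)
  -- with nonzero polynomial factors d_i; equality by cross-multiplication.

  record RatFun (m : ℕ) : Set (c ⊔ ℓ) where
    constructor frac
    field
      num  : Poly m
      dens : List (NZPoly m)
    den : Poly m
    den = prodP dens
  open RatFun public

  _≈R_ : ∀ {m} → RatFun m → RatFun m → Set ℓ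
  r ≈R s = (num r *P den s) ≈P (num s *P den r)

  0R 1R : ∀ {m} → RatFun m
  0R = frac 0P []
  1R = frac 1P []

  _+R_ : ∀ {m} → RatFun m → RatFun m → RatFun m
  r +R s = frac ((num r *P den s) +P (num s *P den r)) (dens r ++ dens s)

  -R_ : ∀ {m} → RatFun m → RatFun m
  -R r = frac (-P num r) (dens r)

  _*R_ : ∀ {m} → RatFun m → RatFun m → RatFun m
  r *R s = frac (num r *P num s) (dens r ++ dens s)

  prodR : ∀ {m} → List (RatFun m) → RatFun m
  prodR = foldr _*R_ 1R

  private
    1+0≉0 : ¬ ((1# + 0#) ≈ 0#)
    1+0≉0 h = 1≉0 (trans (sym (+-identityʳ 1#)) h)

    1+[-1+0]≈1 : ∀ {m} → (a b : Exp m) → a ≢ b →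
                 pcoeff ((1# , b) ∷ (- 1# , a) ∷ []) b ≈ 1# + 0#
    1+[-1+0]≈1 a b a≢b with b ≟e b
    ... | no b≢b = ⊥-elim' (b≢b ≡-refl)
      where ⊥-elim' : ⊥ → _
            ⊥-elim' ()
    ... | yes _ with a ≟e b
    ...   | yes a≡b = ⊥-elim' (a≢b a≡b)
      where ⊥-elim' : ⊥ → _
            ⊥-elim' ()
    ...   | no _ = refl

    monoCoeff : ∀ {m} (e : Exp m) → pcoeff (mono e) e ≈ 1# + 0#
    monoCoeff e with e ≟e e
    ... | yes _ = refl
    ... | no e≢e = ⊥-elim' (e≢e ≡-refl)
      where ⊥-elim' : ⊥ → _
            ⊥-elim' ()

  mono≉0 : ∀ {m} (e : Exp m) → ¬ (mono e ≈P 0P)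
  mono≉0 e h = 1+0≉0 (trans (sym (monoCoeff e)) (h e))

  binom≉0 : ∀ {m} (a b : Exp m) → a ≢ b → ¬ (((1# , b) ∷ (- 1# , a) ∷ []) ≈P 0P)
  binom≉0 a b a≢b h = 1+0≉0 (trans (sym (1+[-1+0]≈1 a b a≢b)) (h b))

  -- K(q): q_1..q_{n-1} are the variables x_1..x_m (n = m+1), and
  -- q_n := (q_1 ⋯ q_{n-1})⁻¹ = 1 / x^(1,…,1).

  count : ∀ {n} → Fin n → List (Fin n) → ℕ
  count x w = length (filter (Fin._≟ x) w)

  -- For a word u over {1..n}, ∏_{ℓ ∈ u} q_ℓ = x^(expNum u) / x^(expDen u).
  expNum : ∀ {m} → List (Fin (suc m)) → Exp m
  expNum u = tabulate (λ i → count (inject₁ i) u)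

  expDen : ∀ {m} → List (Fin (suc m)) → Exp m
  expDen {m} u = replicate m (count (fromℕ m) u)

  qProd : ∀ {m} → List (Fin (suc m)) → RatFun m
  qProd u = frac (mono (expNum u)) ((mono (expDen u) , mono≉0 (expDen u)) ∷ [])

  -- 1 / (1 - q_u) = x^b / (x^b - x^a)  where q_u = x^a / x^b.
  -- (a = b never happens for the nonempty proper prefixes used below,
  --  since then q_u ≠ 1; the `yes` branch is unreachable junk.)
  recipOneMinus : ∀ {m} → List (Fin (suc m)) → RatFun m
  recipOneMinus u with expNum u ≟e expDen u
  ... | yes _  = 0R
  ... | no a≢b = frac (mono (expDen u))
                      ((((1# , expDen u) ∷ (- 1# , expNum u) ∷ []) ,
                        binom≉0 (expNum u) (expDen u) a≢b) ∷ [])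

  coeffE : ∀ {m} → List (Fin (suc m)) → RatFun m
  coeffE {m} σ =
    prodR (map (λ j → if descentAt σ j then qProd (take j σ) else 1R) js)
    *R prodR (map (λ i → recipOneMinus (take i σ)) js)
    where js = map suc (upTo m)

  -- The free associative algebra K(q)⟨X⟩, X = {1..n}: finite formal sums
  -- of words with coefficients in K(q); equality = equal coefficients.

  Word : ℕ → Set
  Word n = List (Fin n)

  _≟w_ : ∀ {n} → (v w : Word n) → Dec (v ≡ w)
  _≟w_ = ListP.≡-dec Fin._≟_

  FA : (m : ℕ) → Set (c ⊔ ℓ)
  FA m = List (RatFun m × Word (suc m))

  acoeff : ∀ {m} → FA m → Word (suc m) → RatFun m
  acoeff [] w = 0R
  acoeff ((r , v) ∷ p) w with v ≟w w
  ... | yes _ = r +R acoeff p w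
  ... | no  _ = acoeff p w

  _≈A_ : ∀ {m} → FA m → FA m → Set ℓ
  p ≈A q = ∀ w → acoeff p w ≈R acoeff q w

  _+A_ : ∀ {m} → FA m → FA m → FA m
  p +A q = p ++ q

  _·A_ : ∀ {m} → RatFun m → FA m → FA m
  r ·A p = map (λ t → (r *R proj₁ t , proj₂ t)) p

  _*A_ : ∀ {m} → FA m → FA m → FA m
  p *A q = concatMap (λ t → map (λ u → (proj₁ t *R proj₁ u , proj₂ t ++ proj₂ u)) q) p

  ⟦_,_⟧ : ∀ {m} → FA m → FA m → FA m
  ⟦ p , q ⟧ = (p *A q) +A ((-R 1R) ·A (q *A p))

  data IsLie {m : ℕ} : FA m → Set (c ⊔ ℓ) where
    gen  : (x : Fin (suc m)) → IsLie ((1R , x ∷ []) ∷ [])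
    zer  : IsLie []
    add  : ∀ {p q} → IsLie p → IsLie q → IsLie (p +A q)
    scl  : ∀ {p} (r : RatFun m) → IsLie p → IsLie (r ·A p)
    brk  : ∀ {p q} → IsLie p → IsLie q → IsLie ⟦ p , q ⟧
    resp : ∀ {p q} → IsLie p → p ≈A q → IsLie q

  eN : (m : ℕ) → FA m
  eN m = map (λ σ → (coeffE σ , σ)) (Sn (suc m))

{-# OPTIONS --safe #-}
-- Write f(w) for the coefficient of w in e_n(q), and let z be a letter.
-- Right-normed brackets [t₁,[t₂,…[t_k,z]]] are dual to shuffles: the coefficient of u z v in
-- such a bracket is (-1)^|v| times the multiplicity of t in the shuffle of u with the
-- reversal ṽ.  Hence e_n(q) = Σ_t f(tz) [t₁,[t₂,…[t_k,z]]] as soon as f(u z v) is (-1)^|v|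
-- times the sum of f(sz) over the shuffles s of u and ṽ.  Now f(sz) is the generating
-- function of the P-partitions of the chain s over z, which is multiplicative over shuffles,
-- and since q_1⋯q_n = 1 the factors of f(u z v) at prefixes beyond z turn into minus the
-- factors of ṽ, so that f(u z v) = (-1)^|v| f(uz) f(ṽz).
module Submission where

open import Defs
open import Level using (_⊔_)
open import Algebra.Bundles using (CommutativeRing; RawRing)
import Algebra.Morphism.RingMonomorphism as RingMonomorphism
open import Algebra.Morphism.Structures using (IsRingMonomorphism)
import Algebra.Properties.CommutativeSemigroup as CommutativeSemigroupProperties
import Algebra.Properties.Group as GroupProperties
import Algebra.Properties.Ring as RingProperties
import Algebra.Solver.Ring.NaturalCoefficients.Default as NaturalCoefficients
open import Algebra.Structures using (IsCommutativeRing)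
open import Data.Bool using (Bool; true; false; if_then_else_)
open import Data.Empty using (⊥-elim)
open import Data.Fin as Fin using (Fin; inject₁; fromℕ)
import Data.Fin.Properties as FinP
open import Data.Fin.Relation.Unary.Top using (view; ‵fromℕ; ‵inj₁)
open import Data.List using (List; []; _∷_; _++_; [_]; _∷ʳ_; map; concatMap; filter; foldr; length; reverse;
  take; drop; allFin; upTo; applyUpTo; tabulate)
import Data.List.Membership.DecPropositional as DecMembership
open import Data.List.Membership.Propositional using (_∈_; _∉_; find; lose)
open import Data.List.Membership.Propositional.Properties
  using (∈-++⁺ˡ; ∈-++⁺ʳ; ∈-++⁻; ∈-∃++; ∈-map⁺; ∈-map⁻; ∈-concatMap⁺; ∈-concatMap⁻; ∈-allFin)
import Data.List.Properties as ListP
open import Data.List.Relation.Binary.Disjoint.Propositional using (Disjoint)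
open import Data.List.Relation.Binary.Permutation.Propositional as Perm
  using (_↭_; ↭-refl; ↭-sym; ↭-trans; ↭-reflexive)
open import Data.List.Relation.Binary.Permutation.Propositional.Properties
  using (shift; drop-mid; ++-comm; ++⁺ˡ; ↭-reverse; ↭-length; ↭-empty-inv; ∈-resp-↭)
open import Data.List.Relation.Binary.Permutation.Setoid.Properties using (Unique-resp-↭)
open import Data.List.Relation.Unary.All as All using (All; []; _∷_)
import Data.List.Relation.Unary.All.Properties as AllP
open import Data.List.Relation.Unary.AllPairs using (AllPairs; []; _∷_)
import Data.List.Relation.Unary.AllPairs.Properties as AllPairsP
open import Data.List.Relation.Unary.Any using (here; there)
open import Data.List.Relation.Unary.Unique.Propositional using (Unique)
import Data.List.Relation.Unary.Unique.Propositional.Properties as UniqueP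
open import Data.Nat as ℕ using (ℕ; zero; suc)
open import Data.Nat.Induction using (<-wellFounded)
import Data.Nat.Properties as ℕP
open import Data.Product using (∃; _×_; _,_; proj₁; proj₂)
open import Data.Sum using (inj₁; inj₂)
open import Data.Vec as Vec using (Vec; []; _∷_; lookup; replicate; zipWith)
import Data.Vec.Properties as VecP
open import Function using (_∘_)
open import Induction.WellFounded using (Acc; acc)
open import Relation.Binary.Definitions using (DecidableEquality; Tri; tri<; tri≈; tri>)
open import Relation.Binary.PropositionalEquality as ≡ using (_≡_; _≢_)
import Relation.Binary.Reasoning.Setoid as SetoidReasoning
open import Relation.Nullary using (Dec; yes; no; does; ¬?)
open import Relation.Nullary.Decidable using (⌊_⌋; dec-true; dec-false)

-- The factor of a prefix depends only on the set of its letters, apart from one bit for the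
-- descent. When a shuffle is read from `z` outwards, the factor next to `z` involves all the
-- letters, so it does not see how the rest is interleaved. Multiplicativity then comes down to one
-- identity between the fractions 1/(1 - a), 1/(1 - b) and 1/(1 - ab). This needs only a commutative
-- ring with a multiplicative weight `Q` and inverses of `1 - Q`, and the combinatorics is done over
-- such a ring.
--
-- The remaining obstacle is K(q). Equality in `K` need not be decidable, so a nonzero polynomial is
-- not known to be a non-zero-divisor, and arbitrary fractions are not known to form a ring. The
-- denominators in e_n are built from monomials and differences of two distinct monomials. These are
-- shown to be cancellable without searching for a leading term, and all calculations take place
-- among fractions with cancellable denominators. Their operations are those of `RatFun`, so the
-- result can be read off there.

-- Sums over shuffles of two words

module ShuffleSum {a c ℓ} {A : Set a} (R : CommutativeRing c ℓ) where
  open CommutativeRing R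
  open CommutativeSemigroupProperties +-commutativeSemigroup using (interchange; x∙yz≈y∙xz; xy∙z≈xz∙y)
  open SetoidReasoning setoid

  -- Shuffles are never listed. A sum over them, with multiplicity, is a recursion on the first
  -- letter, which is the form in which both the generating functions and the bracket coefficients
  -- are computed.
  shuffleSum : List A → List A → (List A → Carrier) → Carrier
  shuffleSum []      v       φ = φ v
  shuffleSum (x ∷ u) []      φ = φ (x ∷ u)
  shuffleSum (x ∷ u) (y ∷ v) φ = shuffleSum u (y ∷ v) (φ ∘ (x ∷_)) + shuffleSum (x ∷ u) v (φ ∘ (y ∷_))

  -- The hypothesis is restricted to rearrangements of `u ++ v` because most functions compared
  -- later agree only there: a weight is determined by the letters of a shuffle.
  shuffleSum-cong : ∀ u v {φ ψ} → (∀ s → s ↭ u ++ v → φ s ≈ ψ s) → shuffleSum u v φ ≈ shuffleSum u v ψ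
  shuffleSum-cong []      v       h = h v ↭-refl
  shuffleSum-cong (x ∷ u) []      h = h (x ∷ u) (↭-reflexive (≡.sym (ListP.++-identityʳ (x ∷ u))))
  shuffleSum-cong (x ∷ u) (y ∷ v) h = +-cong
    (shuffleSum-cong u (y ∷ v) (λ s p → h (x ∷ s) (Perm.prep x p)))
    (shuffleSum-cong (x ∷ u) v (λ s p → h (y ∷ s) (↭-trans (Perm.prep y p) (↭-sym (shift y (x ∷ u) v)))))

  shuffleSum-*ʳ : ∀ u v φ k → shuffleSum u v (λ s → φ s * k) ≈ shuffleSum u v φ * k
  shuffleSum-*ʳ []      v       φ k = refl
  shuffleSum-*ʳ (x ∷ u) []      φ k = refl
  shuffleSum-*ʳ (x ∷ u) (y ∷ v) φ k = trans
    (+-cong (shuffleSum-*ʳ u (y ∷ v) _ k) (shuffleSum-*ʳ (x ∷ u) v _ k))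
    (sym (distribʳ k _ _))

  shuffleSum-0 : ∀ u v → shuffleSum u v (λ _ → 0#) ≈ 0#
  shuffleSum-0 []      v       = refl
  shuffleSum-0 (x ∷ u) []      = refl
  shuffleSum-0 (x ∷ u) (y ∷ v) = trans
    (+-cong (shuffleSum-0 u (y ∷ v)) (shuffleSum-0 (x ∷ u) v)) (+-identityˡ 0#)

  shuffleSum-[]ʳ : ∀ u φ → shuffleSum u [] φ ≈ φ u
  shuffleSum-[]ʳ []      φ = refl
  shuffleSum-[]ʳ (x ∷ u) φ = refl

  -- The recursion takes letters from the front. Taking off a first letter commutes with taking off
  -- a last one, so the same rule holds at the back, which is what reversing the words requires.
  shuffleSum-∷ʳ : ∀ u x v y φ → shuffleSum (u ∷ʳ x) (v ∷ʳ y) φ ≈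
    shuffleSum u (v ∷ʳ y) (φ ∘ (_∷ʳ x)) + shuffleSum (u ∷ʳ x) v (φ ∘ (_∷ʳ y))
  shuffleSum-∷ʳ []      x []      y φ = +-comm _ _
  shuffleSum-∷ʳ []      x (b ∷ v) y φ = trans
    (+-congˡ (shuffleSum-∷ʳ [] x v y (φ ∘ (b ∷_)))) (x∙yz≈y∙xz _ _ _)
  shuffleSum-∷ʳ (a ∷ u) x []      y φ = begin
    shuffleSum (u ∷ʳ x) [ y ] (φ ∘ (a ∷_)) + φ (y ∷ a ∷ u ∷ʳ x)
      ≈⟨ +-congʳ (shuffleSum-∷ʳ u x [] y (φ ∘ (a ∷_))) ⟩
    (shuffleSum u [ y ] (φ ∘ (a ∷_) ∘ (_∷ʳ x)) + shuffleSum (u ∷ʳ x) [] (φ ∘ (a ∷_) ∘ (_∷ʳ y))) + φ (y ∷ a ∷ u ∷ʳ x)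
      ≈⟨ +-congʳ (+-congˡ (shuffleSum-[]ʳ (u ∷ʳ x) _)) ⟩
    (shuffleSum u [ y ] (φ ∘ (a ∷_) ∘ (_∷ʳ x)) + φ (a ∷ (u ∷ʳ x) ∷ʳ y)) + φ (y ∷ a ∷ u ∷ʳ x)
      ≈⟨ xy∙z≈xz∙y _ _ _ ⟩
    (shuffleSum u [ y ] (φ ∘ (a ∷_) ∘ (_∷ʳ x)) + φ (y ∷ a ∷ u ∷ʳ x)) + φ (a ∷ (u ∷ʳ x) ∷ʳ y) ∎
  shuffleSum-∷ʳ (a ∷ u) x (b ∷ v) y φ = trans
    (+-cong (shuffleSum-∷ʳ u x (b ∷ v) y (φ ∘ (a ∷_))) (shuffleSum-∷ʳ (a ∷ u) x v y (φ ∘ (b ∷_))))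
    (interchange _ _ _ _)

  shuffleSum-reverse : ∀ u v φ → shuffleSum (reverse u) (reverse v) φ ≈ shuffleSum u v (φ ∘ reverse)
  shuffleSum-reverse []      v       φ = refl
  shuffleSum-reverse (x ∷ u) []      φ = shuffleSum-[]ʳ (reverse (x ∷ u)) φ
  shuffleSum-reverse (x ∷ u) (y ∷ v) φ = begin
    shuffleSum (reverse (x ∷ u)) (reverse (y ∷ v)) φ
      ≡⟨ ≡.cong₂ (λ u v → shuffleSum u v φ) (ListP.unfold-reverse x u) (ListP.unfold-reverse y v) ⟩
    shuffleSum (reverse u ∷ʳ x) (reverse v ∷ʳ y) φ
      ≈⟨ shuffleSum-∷ʳ (reverse u) x (reverse v) y φ ⟩
    shuffleSum (reverse u) (reverse v ∷ʳ y) (φ ∘ (_∷ʳ x)) + shuffleSum (reverse u ∷ʳ x) (reverse v) (φ ∘ (_∷ʳ y))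
      ≡⟨ ≡.cong₂ (λ u′ v′ → shuffleSum (reverse u) v′ (φ ∘ (_∷ʳ x)) + shuffleSum u′ (reverse v) (φ ∘ (_∷ʳ y)))
           (≡.sym (ListP.unfold-reverse x u)) (≡.sym (ListP.unfold-reverse y v)) ⟩
    shuffleSum (reverse u) (reverse (y ∷ v)) (φ ∘ (_∷ʳ x)) + shuffleSum (reverse (x ∷ u)) (reverse v) (φ ∘ (_∷ʳ y))
      ≈⟨ +-cong (shuffleSum-reverse u (y ∷ v) _) (shuffleSum-reverse (x ∷ u) v _) ⟩
    shuffleSum u (y ∷ v) (λ s → φ (reverse s ∷ʳ x)) + shuffleSum (x ∷ u) v (λ s → φ (reverse s ∷ʳ y))
      ≈⟨ +-cong (shuffleSum-cong u (y ∷ v) (λ s _ → reflexive (≡.cong φ (≡.sym (ListP.unfold-reverse x s)))))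
                (shuffleSum-cong (x ∷ u) v (λ s _ → reflexive (≡.cong φ (≡.sym (ListP.unfold-reverse y s))))) ⟩
    shuffleSum (x ∷ u) (y ∷ v) (φ ∘ reverse) ∎

  sign : List A → Carrier
  sign []      = 1#
  sign (_ ∷ v) = - sign v

  sign-∷ʳ : ∀ v x → sign (v ∷ʳ x) ≈ - sign v
  sign-∷ʳ []      x = refl
  sign-∷ʳ (y ∷ v) x = -‿cong (sign-∷ʳ v x)

  sign-reverse : ∀ v → sign (reverse v) ≈ sign v
  sign-reverse []      = refl
  sign-reverse (x ∷ v) = begin
    sign (reverse (x ∷ v))  ≡⟨ ≡.cong sign (ListP.unfold-reverse x v) ⟩
    sign (reverse v ∷ʳ x)   ≈⟨ sign-∷ʳ (reverse v) x ⟩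
    - sign (reverse v)      ≈⟨ -‿cong (sign-reverse v) ⟩
    - sign v                ∎

-- Words with distinct letters, and their prefixes

∉-++ : ∀ {a} {A : Set a} {z : A} u {v} → z ∉ u → z ∉ v → z ∉ u ++ v
∉-++ u z∉u z∉v z∈ with ∈-++⁻ u z∈
... | inj₁ z∈u = z∉u z∈u
... | inj₂ z∈v = z∉v z∈v

unique-↭ : ∀ {a} {A : Set a} {u v : List A} → u ↭ v → Unique u → Unique v
unique-↭ u↭v = Unique-resp-↭ (≡.setoid _) (Perm.↭⇒↭ₛ u↭v)

unique-∷⇒∉ : ∀ {a} {A : Set a} {x : A} {u} → Unique (x ∷ u) → x ∉ u
unique-∷⇒∉ (x≢u ∷ _) x∈u = All.lookup x≢u x∈u ≡.refl

unique-mid⇒∉ : ∀ {a} {A : Set a} (u : List A) {x v} → Unique (u ++ x ∷ v) → x ∉ u ++ v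
unique-mid⇒∉ u {x} {v} uniq = unique-∷⇒∉ (unique-↭ (shift x u v) uniq)

unique-++⇒disjoint : ∀ {a} {A : Set a} (u : List A) {v} → Unique (u ++ v) → Disjoint u v
unique-++⇒disjoint (x ∷ u) uniq       (here ≡.refl , z∈v) = unique-∷⇒∉ uniq (∈-++⁺ʳ u z∈v)
unique-++⇒disjoint (x ∷ u) (_ ∷ uniq) (there z∈u , z∈v)   = unique-++⇒disjoint u uniq (z∈u , z∈v)

take-∷ʳ : ∀ {a} {A : Set a} (p : List A) {x s} → take (suc (length p)) (p ++ x ∷ s) ≡ p ∷ʳ x
take-∷ʳ []      = ≡.refl
take-∷ʳ (y ∷ p) = ≡.cong (y ∷_) (take-∷ʳ p)

drop-length : ∀ {a} {A : Set a} (p : List A) {s} → drop (length p) (p ++ s) ≡ s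
drop-length []      = ≡.refl
drop-length (y ∷ p) = drop-length p

-- Positions are counted from 1, so the letter behind `p` sits at `suc (length p)`.
descentAt-mid : ∀ {n} (p : List (Fin n)) {x y s} →
  descentAt (p ++ x ∷ y ∷ s) (suc (length p)) ≡ ⌊ y Fin.<? x ⌋
descentAt-mid p {x} {y} {s} rewrite drop-length p {x ∷ y ∷ s} = ≡.refl

-- Identities between the fractions 1/(1 - a), 1/(1 - b), 1/(1 - ab)

module ScalarIdentities {c ℓ} (R : CommutativeRing c ℓ) where
  open CommutativeRing R
  open RingProperties ring using (-‿distribʳ-*; -‿involutive; -‿+-comm)
  open NaturalCoefficients commutativeSemiring using (solve; _:=_; _:+_; _:*_; con)
  open SetoidReasoning setoid

  weight : Bool → Carrier → Carrier
  weight d a = if d then a else 1#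

  -- The sum b/(1 - b) + 1/(1 - a) = (1 - ab)/((1 - a)(1 - b)), cleared of denominators.
  telescope : ∀ a b → b * (1# - a) + (1# - b) ≈ 1# - a * b
  telescope a b = begin
    b * (1# - a) + (1# - b)
      ≈⟨ solve 3 (λ b m n → b :* (con 1 :+ m) :+ (con 1 :+ n) := (b :+ n) :+ (con 1 :+ b :* m)) refl b (- a) (- b) ⟩
    (b - b) + (1# + b * (- a))
      ≈⟨ +-cong (-‿inverseʳ b) (+-congˡ (trans (sym (-‿distribʳ-* b a)) (-‿cong (*-comm b a)))) ⟩
    0# + (1# - a * b)
      ≈⟨ +-identityˡ _ ⟩
    1# - a * b ∎

  module _ {a b ra rb rt : Carrier} (inv-a : ra * (1# - a) ≈ 1#) (inv-b : rb * (1# - b) ≈ 1#)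
           (inv-ab : rt * (1# - a * b) ≈ 1#) where

    private
      -- Clears denominators when only the inverses are at hand: each summand is multiplied by the
      -- unit `ra * (1# - a)` or `rb * (1# - b)` that it lacks, and `rt` then cancels against
      -- `1# - a * b`.
      insert-ones : ∀ s t k → rt * (s * (ra * (1# - a)) + t * (rb * (1# - b))) ≈ k * (rt * (1# - a * b)) →
                    rt * (s + t) ≈ k
      insert-ones s t k eq = begin
        rt * (s + t)
          ≈⟨ *-congˡ (+-cong (sym (trans (*-congˡ inv-a) (*-identityʳ s))) (sym (trans (*-congˡ inv-b) (*-identityʳ t)))) ⟩
        rt * (s * (ra * (1# - a)) + t * (rb * (1# - b)))  ≈⟨ eq ⟩
        k * (rt * (1# - a * b))                           ≈⟨ *-congˡ inv-ab ⟩
        k * 1#                                            ≈⟨ *-identityʳ k ⟩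
        k                                                 ∎

    unit-identity : rt * (b * rb + ra) ≈ ra * rb
    unit-identity = insert-ones _ _ _ (trans
      (solve 6 (λ b ra rb rt u v →
         rt :* (b :* rb :* (ra :* u) :+ ra :* (rb :* v)) := ra :* rb :* (rt :* (b :* u :+ v)))
         refl b ra rb rt (1# - a) (1# - b))
      (*-congˡ (*-congˡ (telescope a b))))

    mixed-identity : rt * (b * rb + (a * b) * ra) ≈ ra * (b * rb)
    mixed-identity = insert-ones _ _ _ (trans
      (solve 7 (λ a b ra rb rt u v →
         rt :* (b :* rb :* (ra :* u) :+ (a :* b) :* ra :* (rb :* v)) := ra :* (b :* rb) :* (rt :* (a :* v :+ u)))
         refl a b ra rb rt (1# - a) (1# - b))
      (*-congˡ (*-congˡ (trans (telescope b a) (+-congˡ (-‿cong (*-comm b a)))))))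

    -- Two chains over `z` have lowest letters x < y and weights `a` and `b`. The first summand
    -- collects the pairs of P-partitions whose value at y exceeds the value at x, the second those
    -- whose value at x is at least the value at y; together they exhaust the product. The bits `zx`
    -- and `zy` say whether z < x and z < y, that is, whether the step up from `z` is strict, and x
    -- < y makes the first imply the second.
    shuffle-identity : ∀ zx zy → (zx ≡ true → zy ≡ true) →
      (weight true b * rb) * (weight zx (a * b) * rt) + (weight false a * ra) * (weight zy (a * b) * rt)
        ≈ (weight zx a * ra) * (weight zy b * rb)
    shuffle-identity true  true  _ = trans
      (solve 5 (λ a b ra rb rt →
         b :* rb :* (a :* b :* rt) :+ con 1 :* ra :* (a :* b :* rt) := (a :* b) :* (rt :* (b :* rb :+ ra)))
         refl a b ra rb rt)
      (trans (*-congˡ unit-identity)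
        (solve 4 (λ a b ra rb → (a :* b) :* (ra :* rb) := (a :* ra) :* (b :* rb)) refl a b ra rb))
    shuffle-identity true  false h with () ← h ≡.refl
    shuffle-identity false true  _ = trans
      (solve 5 (λ a b ra rb rt →
         b :* rb :* (con 1 :* rt) :+ con 1 :* ra :* (a :* b :* rt) := rt :* (b :* rb :+ (a :* b) :* ra))
         refl a b ra rb rt)
      (trans mixed-identity (*-congʳ (sym (*-identityˡ ra))))
    shuffle-identity false false _ = trans
      (solve 4 (λ b ra rb rt →
         b :* rb :* (con 1 :* rt) :+ con 1 :* ra :* (con 1 :* rt) := rt :* (b :* rb :+ ra))
         refl b ra rb rt)
      (trans unit-identity (*-cong (sym (*-identityˡ ra)) (sym (*-identityˡ rb))))

  -- With b = 1/a one has 1/(1 - 1/a) = -a/(1 - a). Passing to the complementary set of letters thus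
  -- exchanges the factor of a descent with that of an ascent, up to sign.
  complement-identity : ∀ {a b ra rb} → ra * (1# - a) ≈ 1# → rb * (1# - b) ≈ 1# → a * b ≈ 1# → a * ra ≈ - rb
  complement-identity {a} {b} {ra} {rb} inv-a inv-b ab≈1 = begin
    a * ra                           ≈⟨ *-identityʳ _ ⟨
    a * ra * 1#                      ≈⟨ *-congˡ inv-b ⟨
    a * ra * (rb * (1# - b))         ≈⟨ solve 4 (λ a ra rb v → a :* ra :* (rb :* v) := rb :* (ra :* (a :* v))) refl a ra rb (1# - b) ⟩
    rb * (ra * (a * (1# - b)))       ≈⟨ *-congˡ (*-congˡ a[1-b]) ⟩
    rb * (ra * - (1# - a))           ≈⟨ *-congˡ (-‿distribʳ-* ra _) ⟨
    rb * - (ra * (1# - a))           ≈⟨ *-congˡ (-‿cong inv-a) ⟩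
    rb * - 1#                        ≈⟨ -‿distribʳ-* rb 1# ⟨
    - (rb * 1#)                      ≈⟨ -‿cong (*-identityʳ rb) ⟩
    - rb                             ∎
    where
    a[1-b] : a * (1# - b) ≈ - (1# - a)
    a[1-b] = begin
      a * (1# - b)         ≈⟨ distribˡ a 1# (- b) ⟩
      a * 1# + a * - b     ≈⟨ +-cong (*-identityʳ a) (sym (-‿distribʳ-* a b)) ⟩
      a + - (a * b)        ≈⟨ +-congˡ (-‿cong ab≈1) ⟩
      a + - 1#             ≈⟨ +-comm a (- 1#) ⟩
      - 1# + a             ≈⟨ +-congˡ (-‿involutive a) ⟨
      - 1# + - - a         ≈⟨ -‿+-comm 1# (- a) ⟩
      - (1# - a)           ∎

-- The coefficients of e_n over a ring with prefix weights

record PrefixWeights {c ℓ} (R : CommutativeRing c ℓ) (m : ℕ) : Set (c ⊔ ℓ) where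
  open CommutativeRing R
  field
    Q r       : List (Fin (suc m)) → Carrier
    Q-[]      : Q [] ≈ 1#
    Q-∷       : ∀ x u → Q (x ∷ u) ≈ Q [ x ] * Q u
    -- The missing letter `z` keeps `u` away from the relation q_1⋯q_n = 1. That relation enters
    -- separately, as a hypothesis `Q (…) ≈ 1#` on complete words.
    r-inverse : ∀ u z → u ≢ [] → z ∉ u → r u * (1# - Q u) ≈ 1#

module KlyachkoCoefficients {c ℓ} (R : CommutativeRing c ℓ) (m : ℕ) (weights : PrefixWeights R m) where
  open CommutativeRing R
  open PrefixWeights weights
  open ShuffleSum {A = Fin (suc m)} R
  open ScalarIdentities R
  open RingProperties ring using (-‿distribˡ-*; -‿involutive)
  open CommutativeSemigroupProperties *-commutativeSemigroup using (interchange)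
  open NaturalCoefficients commutativeSemiring using (solve; _:=_; _:+_; _:*_)
  open SetoidReasoning setoid

  Q-↭ : ∀ {u v} → u ↭ v → Q u ≈ Q v
  Q-↭ Perm.refl = refl
  Q-↭ (Perm.prep {u} {v} x p) = trans (Q-∷ x u) (trans (*-congˡ (Q-↭ p)) (sym (Q-∷ x v)))
  Q-↭ (Perm.swap {u} {v} x y p) = begin
    Q (x ∷ y ∷ u)               ≈⟨ trans (Q-∷ x _) (*-congˡ (Q-∷ y u)) ⟩
    Q [ x ] * (Q [ y ] * Q u)   ≈⟨ solve 3 (λ a b c → a :* (b :* c) := b :* (a :* c)) refl _ _ _ ⟩
    Q [ y ] * (Q [ x ] * Q u)   ≈⟨ *-congˡ (*-congˡ (Q-↭ p)) ⟩
    Q [ y ] * (Q [ x ] * Q v)   ≈⟨ trans (Q-∷ y _) (*-congˡ (Q-∷ x v)) ⟨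
    Q (y ∷ x ∷ v)               ∎
  Q-↭ (Perm.trans p q) = trans (Q-↭ p) (Q-↭ q)

  Q-++ : ∀ u v → Q (u ++ v) ≈ Q u * Q v
  Q-++ []      v = trans (sym (*-identityˡ _)) (*-congʳ (sym Q-[]))
  Q-++ (x ∷ u) v = begin
    Q (x ∷ u ++ v)         ≈⟨ Q-∷ x (u ++ v) ⟩
    Q [ x ] * Q (u ++ v)   ≈⟨ *-congˡ (Q-++ u v) ⟩
    Q [ x ] * (Q u * Q v)  ≈⟨ *-assoc _ _ _ ⟨
    Q [ x ] * Q u * Q v    ≈⟨ *-congʳ (Q-∷ x u) ⟨
    Q (x ∷ u) * Q v        ∎

  -- Nothing says that `r u` depends on `u` through `Q u` alone; uniqueness of inverses gives it
  -- wherever both words miss a letter.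
  r-cong : ∀ {u v z} → u ≢ [] → v ≢ [] → z ∉ u → z ∉ v → Q u ≈ Q v → r u ≈ r v
  r-cong {u} {v} {z} u≢[] v≢[] z∉u z∉v Qu≈Qv = begin
    r u                       ≈⟨ *-identityʳ _ ⟨
    r u * 1#                  ≈⟨ *-congˡ (r-inverse v z v≢[] z∉v) ⟨
    r u * (r v * (1# - Q v))  ≈⟨ *-congˡ (*-congˡ (+-congˡ (-‿cong Qu≈Qv))) ⟨
    r u * (r v * (1# - Q u))  ≈⟨ solve 3 (λ a b c → a :* (b :* c) := b :* (a :* c)) refl _ _ _ ⟩
    r v * (r u * (1# - Q u))  ≈⟨ *-congˡ (r-inverse u z u≢[] z∉u) ⟩
    r v * 1#                  ≈⟨ *-identityʳ _ ⟩
    r v                       ∎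

  factor : Bool → List (Fin (suc m)) → Carrier
  factor d w = weight d (Q w) * r w

  weight-cong : ∀ d {a b} → a ≈ b → weight d a ≈ weight d b
  weight-cong true  a≈b = a≈b
  weight-cong false a≈b = refl

  factor-↭ : ∀ d {x u v z} → z ∉ v → v ↭ x ∷ u → factor d v ≈ factor d (x ∷ u)
  factor-↭ d {x} {u} {v} {z} z∉v p =
    *-cong (weight-cong d (Q-↭ p))
      (r-cong (λ { ≡.refl → ⊥-elim (∉[] (∈-resp-↭ (↭-sym p) (here ≡.refl))) }) (λ ()) z∉v
        (z∉v ∘ ∈-resp-↭ (↭-sym p)) (Q-↭ p))
    where
    ∉[] : x ∉ []
    ∉[] ()

  -- The argument `p` is the part of the word already read, so that the step from `x` to `y` is
  -- weighted by the prefix ending in `x`. The last letter contributes no factor, since the products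
  -- in e_n stop at length n - 1.
  chain : List (Fin (suc m)) → List (Fin (suc m)) → Carrier
  chain p []          = 1#
  chain p (x ∷ [])    = 1#
  chain p (x ∷ y ∷ s) = factor ⌊ y Fin.<? x ⌋ (p ∷ʳ x) * chain (p ∷ʳ x) (y ∷ s)

  chain-++ : ∀ p u z v → chain p (u ++ z ∷ v) ≈ chain p (u ∷ʳ z) * chain (p ++ u) (z ∷ v)
  chain-++ p []          z v rewrite ListP.++-identityʳ p = sym (*-identityˡ _)
  chain-++ p (x ∷ [])    z v = *-congʳ (sym (*-identityʳ _))
  chain-++ p (x ∷ y ∷ u) z v = begin
    _ * chain (p ∷ʳ x) (y ∷ u ++ z ∷ v)
      ≈⟨ *-congˡ (chain-++ (p ∷ʳ x) (y ∷ u) z v) ⟩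
    _ * (chain (p ∷ʳ x) (y ∷ u ∷ʳ z) * chain ((p ∷ʳ x) ++ y ∷ u) (z ∷ v))
      ≡⟨ ≡.cong (λ w → _ * (chain (p ∷ʳ x) (y ∷ u ∷ʳ z) * chain w (z ∷ v))) (ListP.++-assoc p [ x ] (y ∷ u)) ⟩
    _ * (chain (p ∷ʳ x) (y ∷ u ∷ʳ z) * chain (p ++ x ∷ y ∷ u) (z ∷ v))
      ≈⟨ *-assoc _ _ _ ⟨
    chain p (x ∷ y ∷ u ∷ʳ z) * chain (p ++ x ∷ y ∷ u) (z ∷ v) ∎

  -- The generating function of the P-partitions of the reversed word w that
  -- are bounded below by 0 at a further last letter z (strictly at descents).
  partitionSum : Fin (suc m) → List (Fin (suc m)) → Carrier
  partitionSum z []      = 1#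
  partitionSum z (x ∷ w) = partitionSum x w * factor ⌊ z Fin.<? x ⌋ (x ∷ w)

  -- Both sides have the same factors, evaluated at `reverse w ∷ʳ x` on one side and at `x ∷ w` on
  -- the other. The letter `l`, missing from every prefix involved, makes the factors independent of
  -- the order.
  chain-reverse : ∀ {l} z w → l ∉ w → chain [] (reverse w ∷ʳ z) ≈ partitionSum z w
  chain-reverse z []      l∉w = refl
  chain-reverse z (x ∷ w) l∉w = begin
    chain [] (reverse (x ∷ w) ∷ʳ z)
      ≡⟨ ≡.cong (chain []) (≡.trans (≡.cong (_∷ʳ z) (ListP.unfold-reverse x w)) (ListP.++-assoc (reverse w) [ x ] [ z ])) ⟩
    chain [] (reverse w ++ x ∷ [ z ])
      ≈⟨ chain-++ [] (reverse w) x [ z ] ⟩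
    chain [] (reverse w ∷ʳ x) * (factor ⌊ z Fin.<? x ⌋ (reverse w ∷ʳ x) * 1#)
      ≈⟨ *-cong (chain-reverse x w (l∉w ∘ there))
           (trans (*-identityʳ _) (factor-↭ ⌊ z Fin.<? x ⌋ (l∉w ∘ ∈-resp-↭ reordered) reordered)) ⟩
    partitionSum z (x ∷ w) ∎
    where
    reordered : reverse w ∷ʳ x ↭ x ∷ w
    reordered = ↭-trans (↭-reflexive (≡.sym (ListP.unfold-reverse x w))) (↭-reverse (x ∷ w))

  private
    <?-true : ∀ {x y : Fin (suc m)} → x Fin.< y → ⌊ x Fin.<? y ⌋ ≡ true
    <?-true {x} {y} x<y with x Fin.<? y
    ... | yes _  = ≡.refl
    ... | no x≮y = ⊥-elim (x≮y x<y)

    <?-false : ∀ {x y : Fin (suc m)} → y Fin.< x → ⌊ x Fin.<? y ⌋ ≡ false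
    <?-false {x} {y} y<x with x Fin.<? y
    ... | yes x<y = ⊥-elim (FinP.<-asym x<y y<x)
    ... | no _    = ≡.refl

    <?-mono : ∀ z {x y : Fin (suc m)} → x Fin.< y → ⌊ z Fin.<? x ⌋ ≡ true → ⌊ z Fin.<? y ⌋ ≡ true
    <?-mono z {x} {y} x<y with z Fin.<? x | z Fin.<? y
    ... | _       | yes _  = λ _ → ≡.refl
    ... | yes z<x | no z≮y = ⊥-elim (z≮y (FinP.<-trans z<x x<y))
    ... | no _    | no _   = λ ()

  factor-shuffle : ∀ {l x y} z u v → x ≢ y → l ∉ x ∷ u → l ∉ y ∷ v →
    let w = x ∷ u ++ y ∷ v in
    factor ⌊ x Fin.<? y ⌋ (y ∷ v) * factor ⌊ z Fin.<? x ⌋ w + factor ⌊ y Fin.<? x ⌋ (x ∷ u) * factor ⌊ z Fin.<? y ⌋ w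
      ≈ factor ⌊ z Fin.<? x ⌋ (x ∷ u) * factor ⌊ z Fin.<? y ⌋ (y ∷ v)
  factor-shuffle {l} {x} {y} z u v x≢y l∉xu l∉yv = trans
    (+-cong (*-congˡ (*-congʳ (weight-cong ⌊ z Fin.<? x ⌋ Qw≈))) (*-congˡ (*-congʳ (weight-cong ⌊ z Fin.<? y ⌋ Qw≈))))
    ordered
    where
    w = x ∷ u ++ y ∷ v
    a = Q (x ∷ u)
    b = Q (y ∷ v)
    Qw≈ : Q w ≈ a * b
    Qw≈ = Q-++ (x ∷ u) (y ∷ v)
    inv-a : r (x ∷ u) * (1# - a) ≈ 1#
    inv-a = r-inverse (x ∷ u) l (λ ()) l∉xu
    inv-b : r (y ∷ v) * (1# - b) ≈ 1#
    inv-b = r-inverse (y ∷ v) l (λ ()) l∉yv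
    inv-ab : r w * (1# - a * b) ≈ 1#
    inv-ab = trans (*-congˡ (+-congˡ (-‿cong (sym Qw≈)))) (r-inverse w l (λ ()) (∉-++ (x ∷ u) l∉xu l∉yv))
    ordered :
      factor ⌊ x Fin.<? y ⌋ (y ∷ v) * (weight ⌊ z Fin.<? x ⌋ (a * b) * r w)
        + factor ⌊ y Fin.<? x ⌋ (x ∷ u) * (weight ⌊ z Fin.<? y ⌋ (a * b) * r w)
        ≈ factor ⌊ z Fin.<? x ⌋ (x ∷ u) * factor ⌊ z Fin.<? y ⌋ (y ∷ v)
    ordered with FinP.<-cmp x y
    ... | tri≈ _ x≡y _ = ⊥-elim (x≢y x≡y)
    ... | tri< x<y _ _ rewrite <?-true x<y | <?-false x<y =
      shuffle-identity inv-a inv-b inv-ab _ _ (<?-mono z x<y)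
    -- The same identity with the two chains exchanged; the commutations put the sum and the product
    -- back in order.
    ... | tri> _ _ y<x rewrite <?-true y<x | <?-false y<x = trans (+-comm _ _) (trans
      (+-cong (*-congˡ (*-congʳ (weight-cong ⌊ z Fin.<? y ⌋ (*-comm a b)))) (*-congˡ (*-congʳ (weight-cong ⌊ z Fin.<? x ⌋ (*-comm a b)))))
      (trans (shuffle-identity inv-b inv-a (trans (*-congˡ (+-congˡ (-‿cong (*-comm b a)))) inv-ab) _ _ (<?-mono z y<x))
        (*-comm _ _)))

  -- The factor next to `z` depends only on the first letter of the shuffle and on the set of all
  -- its letters, so it leaves the sum. What remains is a shuffle sum over `x` or over `y`, to which
  -- induction applies, and the common part of the two products is then multiplied by the left side
  -- of `factor-shuffle`.
  partitionSum-shuffle : ∀ {l} u v z → l ∉ u → l ∉ v → Disjoint u v →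
    shuffleSum u v (partitionSum z) ≈ partitionSum z u * partitionSum z v
  partitionSum-shuffle []      v       z l∉u l∉v u#v = sym (*-identityˡ _)
  partitionSum-shuffle (x ∷ u) []      z l∉u l∉v u#v = sym (*-identityʳ _)
  partitionSum-shuffle (x ∷ u) (y ∷ v) z l∉u l∉v u#v = begin
    shuffleSum u (y ∷ v) (λ s → partitionSum x s * factor zx (x ∷ s))
      + shuffleSum (x ∷ u) v (λ s → partitionSum y s * factor zy (y ∷ s))
      ≈⟨ +-cong (shuffleSum-cong u (y ∷ v) (λ s p → *-congˡ (to-w zx (Perm.prep x p))))
                (shuffleSum-cong (x ∷ u) v (λ s p → *-congˡ (to-w zy
                  (↭-trans (Perm.prep y p) (↭-sym (shift y (x ∷ u) v)))))) ⟩
    shuffleSum u (y ∷ v) (λ s → partitionSum x s * factor zx w)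
      + shuffleSum (x ∷ u) v (λ s → partitionSum y s * factor zy w)
      ≈⟨ +-cong (shuffleSum-*ʳ u (y ∷ v) _ _) (shuffleSum-*ʳ (x ∷ u) v _ _) ⟩
    shuffleSum u (y ∷ v) (partitionSum x) * factor zx w
      + shuffleSum (x ∷ u) v (partitionSum y) * factor zy w
      ≈⟨ +-cong (*-congʳ (partitionSum-shuffle u (y ∷ v) x (l∉u ∘ there) l∉v λ (p , q) → u#v (there p , q)))
                (*-congʳ (partitionSum-shuffle (x ∷ u) v y l∉u (l∉v ∘ there) λ (p , q) → u#v (p , there q))) ⟩
    (partitionSum x u * (partitionSum y v * factor ⌊ x Fin.<? y ⌋ (y ∷ v))) * factor zx w
      + ((partitionSum x u * factor ⌊ y Fin.<? x ⌋ (x ∷ u)) * partitionSum y v) * factor zy w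
      ≈⟨ solve 6 (λ f g h i j k → (f :* (g :* h)) :* i :+ ((f :* j) :* g) :* k := (f :* g) :* (h :* i :+ j :* k))
           refl _ _ _ _ _ _ ⟩
    (partitionSum x u * partitionSum y v)
      * (factor ⌊ x Fin.<? y ⌋ (y ∷ v) * factor zx w + factor ⌊ y Fin.<? x ⌋ (x ∷ u) * factor zy w)
      ≈⟨ *-congˡ (factor-shuffle z u v (λ { ≡.refl → u#v (here ≡.refl , here ≡.refl) }) l∉u l∉v) ⟩
    (partitionSum x u * partitionSum y v) * (factor zx (x ∷ u) * factor zy (y ∷ v))
      ≈⟨ solve 4 (λ f g h i → (f :* g) :* (h :* i) := (f :* h) :* (g :* i)) refl _ _ _ _ ⟩
    partitionSum z (x ∷ u) * partitionSum z (y ∷ v) ∎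
    where
    w = x ∷ u ++ y ∷ v
    zx = ⌊ z Fin.<? x ⌋
    zy = ⌊ z Fin.<? y ⌋
    to-w : ∀ d {s} → s ↭ w → factor d s ≈ factor d w
    to-w d p = factor-↭ d (∉-++ (x ∷ u) l∉u l∉v ∘ ∈-resp-↭ p) p

  -- The prefix up to `x` and the suffix from `y` have weights with product 1; the first misses `y`
  -- and the second misses `x`. Comparing the two letters from the other side turns a descent into
  -- an ascent, in agreement with `complement-identity`.
  factor-complement : ∀ {x y} p s → Unique (p ++ x ∷ y ∷ s) → Q (p ++ x ∷ y ∷ s) ≈ 1# →
    factor ⌊ y Fin.<? x ⌋ (p ∷ʳ x) ≈ - factor ⌊ x Fin.<? y ⌋ (y ∷ s)
  factor-complement {x} {y} p s uniq Q≈1 = ordered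
    where
    regroup : (p ∷ʳ x) ++ y ∷ s ≡ p ++ x ∷ y ∷ s
    regroup = ListP.++-assoc p [ x ] (y ∷ s)
    ab≈1 : Q (p ∷ʳ x) * Q (y ∷ s) ≈ 1#
    ab≈1 = trans (sym (Q-++ (p ∷ʳ x) (y ∷ s))) (trans (reflexive (≡.cong Q regroup)) Q≈1)
    ba≈1 : Q (y ∷ s) * Q (p ∷ʳ x) ≈ 1#
    ba≈1 = trans (*-comm _ _) ab≈1
    ∷ʳ≢[] : ∀ p → p ∷ʳ x ≢ []
    ∷ʳ≢[] []      ()
    ∷ʳ≢[] (_ ∷ _) ()
    inv-a : r (p ∷ʳ x) * (1# - Q (p ∷ʳ x)) ≈ 1#
    inv-a = r-inverse (p ∷ʳ x) y (∷ʳ≢[] p)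
      (unique-mid⇒∉ (p ∷ʳ x) (≡.subst Unique (≡.sym regroup) uniq) ∘ ∈-++⁺ˡ)
    inv-b : r (y ∷ s) * (1# - Q (y ∷ s)) ≈ 1#
    inv-b = r-inverse (y ∷ s) x (λ ()) (unique-mid⇒∉ p uniq ∘ ∈-++⁺ʳ p)
    ordered : factor ⌊ y Fin.<? x ⌋ (p ∷ʳ x) ≈ - factor ⌊ x Fin.<? y ⌋ (y ∷ s)
    ordered with FinP.<-cmp x y
    ... | tri≈ _ ≡.refl _ = ⊥-elim (unique-mid⇒∉ p uniq (∈-++⁺ʳ p (here ≡.refl)))
    ... | tri< x<y _ _ rewrite <?-true x<y | <?-false x<y = begin
      1# * r (p ∷ʳ x)               ≈⟨ *-identityˡ _ ⟩
      r (p ∷ʳ x)                    ≈⟨ -‿involutive _ ⟨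
      - - r (p ∷ʳ x)                ≈⟨ -‿cong (complement-identity inv-b inv-a ba≈1) ⟨
      - (Q (y ∷ s) * r (y ∷ s))     ∎
    ... | tri> _ _ y<x rewrite <?-true y<x | <?-false y<x =
      trans (complement-identity inv-a inv-b ab≈1) (-‿cong (sym (*-identityˡ _)))

  -- Each remaining prefix weight is the inverse of the weight of the suffix
  -- that completes it, so the word can be read backwards from its end.
  chain-complement : ∀ p x s → Unique (p ++ x ∷ s) → Q (p ++ x ∷ s) ≈ 1# →
    chain p (x ∷ s) ≈ sign s * partitionSum x s
  chain-complement p x []      uniq Q≈1 = sym (*-identityˡ 1#)
  chain-complement p x (y ∷ s) uniq Q≈1 = begin
    factor ⌊ y Fin.<? x ⌋ (p ∷ʳ x) * chain (p ∷ʳ x) (y ∷ s)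
      ≈⟨ *-cong (factor-complement p s uniq Q≈1)
           (chain-complement (p ∷ʳ x) y s (≡.subst Unique regroup uniq) (trans (reflexive (≡.cong Q (≡.sym regroup))) Q≈1)) ⟩
    - f * (sign s * partitionSum y s)
      ≈⟨ -‿distribˡ-* f _ ⟨
    - (f * (sign s * partitionSum y s))
      ≈⟨ -‿cong (solve 3 (λ f g h → f :* (g :* h) := g :* (h :* f)) refl f _ _) ⟩
    - (sign s * (partitionSum y s * f))
      ≈⟨ -‿distribˡ-* _ _ ⟩
    - sign s * (partitionSum y s * f) ∎
    where
    f = factor ⌊ x Fin.<? y ⌋ (y ∷ s)
    regroup : p ++ x ∷ y ∷ s ≡ (p ∷ʳ x) ++ y ∷ s
    regroup = ≡.sym (ListP.++-assoc p [ x ] (y ∷ s))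

  -- Cutting at `z` leaves two disjoint chains over the same letter, one read backwards from `z` and
  -- one forwards. Here `z` is itself the letter that both miss, so it also serves as the witness
  -- for inverting the weights.
  chain-shuffle : ∀ u z v → Unique (u ++ z ∷ reverse v) → Q (u ++ z ∷ reverse v) ≈ 1# →
    chain [] (u ++ z ∷ reverse v) ≈ sign v * shuffleSum u v (λ s → chain [] (s ∷ʳ z))
  chain-shuffle u z v uniq Q≈1 = begin
    chain [] (u ++ z ∷ reverse v)
      ≈⟨ chain-++ [] u z (reverse v) ⟩
    chain [] (u ∷ʳ z) * chain u (z ∷ reverse v)
      ≈⟨ *-cong (chain-∷ʳ u z∉u) (chain-complement u z (reverse v) uniq Q≈1) ⟩
    partitionSum z (reverse u) * (sign (reverse v) * partitionSum z (reverse v))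
      ≈⟨ solve 3 (λ f g h → f :* (g :* h) := g :* (f :* h)) refl _ _ _ ⟩
    sign (reverse v) * (partitionSum z (reverse u) * partitionSum z (reverse v))
      ≈⟨ *-cong (sign-reverse v) (sym (partitionSum-shuffle (reverse u) (reverse v) z (∉-reverse u z∉u) z∉v̅
           λ (p , q) → unique-++⇒disjoint u uniq (∈-resp-↭ (↭-reverse u) p , there q))) ⟩
    sign v * shuffleSum (reverse u) (reverse v) (partitionSum z)
      ≈⟨ *-congˡ (shuffleSum-reverse u v (partitionSum z)) ⟩
    sign v * shuffleSum u v (partitionSum z ∘ reverse)
      ≈⟨ *-congˡ (shuffleSum-cong u v λ s p → sym (chain-∷ʳ s
           (∉-++ u z∉u (z∉v̅ ∘ ∈-resp-↭ (↭-sym (↭-reverse v))) ∘ ∈-resp-↭ p))) ⟩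
    sign v * shuffleSum u v (λ s → chain [] (s ∷ʳ z)) ∎
    where
    z∉u : z ∉ u
    z∉u = unique-mid⇒∉ u uniq ∘ ∈-++⁺ˡ
    z∉v̅ : z ∉ reverse v
    z∉v̅ = unique-mid⇒∉ u uniq ∘ ∈-++⁺ʳ u
    ∉-reverse : ∀ s → z ∉ s → z ∉ reverse s
    ∉-reverse s z∉s = z∉s ∘ ∈-resp-↭ (↭-reverse s)
    chain-∷ʳ : ∀ s → z ∉ s → chain [] (s ∷ʳ z) ≈ partitionSum z (reverse s)
    chain-∷ʳ s z∉s = trans (reflexive (≡.cong (λ t → chain [] (t ∷ʳ z)) (≡.sym (ListP.reverse-involutive s))))
      (chain-reverse z (reverse s) (∉-reverse s z∉s))

  product : List Carrier → Carrier
  product = foldr _*_ 1#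

  descentFactor reciprocalFactor : List (Fin (suc m)) → ℕ → Carrier
  descentFactor σ j = weight (descentAt σ j) (Q (take j σ))
  reciprocalFactor σ i = r (take i σ)

  -- Follows `coeffE` factor by factor and in the same order, so that over K(q) the two are
  -- propositionally equal and not merely equal as fractions.
  coefficient : List (Fin (suc m)) → Carrier
  coefficient σ = product (map (descentFactor σ) js) * product (map (reciprocalFactor σ) js)
    where js = map suc (upTo m)

  -- The factors are given by arbitrary functions `f` and `g` because the induction replaces them by
  -- `f ∘ suc` and `g ∘ suc`. Index `k` belongs to the prefix of length `suc (length p + k)`.
  chain-product : ∀ p x s (f g : ℕ → Carrier) →
    (∀ k → f k ≡ descentFactor (p ++ x ∷ s) (suc (length p ℕ.+ k))) →
    (∀ k → g k ≡ reciprocalFactor (p ++ x ∷ s) (suc (length p ℕ.+ k))) →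
    product (applyUpTo f (length s)) * product (applyUpTo g (length s)) ≈ chain p (x ∷ s)
  chain-product p x []      f g f≡ g≡ = *-identityˡ 1#
  chain-product p x (y ∷ s) f g f≡ g≡ = trans (interchange _ _ _ _) (*-cong
    (reflexive (≡.cong₂ _*_ first-f first-g))
    (chain-product (p ∷ʳ x) y s (f ∘ suc) (g ∘ suc)
      (λ k → ≡.trans (f≡ (suc k)) (≡.cong₂ descentFactor regroup (index k)))
      (λ k → ≡.trans (g≡ (suc k)) (≡.cong₂ reciprocalFactor regroup (index k)))))
    where
    regroup : p ++ x ∷ y ∷ s ≡ (p ∷ʳ x) ++ y ∷ s
    regroup = ≡.sym (ListP.++-assoc p [ x ] (y ∷ s))
    index : ∀ k → suc (length p ℕ.+ suc k) ≡ suc (length (p ∷ʳ x) ℕ.+ k)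
    index k = ≡.cong suc (≡.trans (≡.sym (ℕP.+-assoc (length p) 1 k)) (≡.cong (ℕ._+ k) (≡.sym (ListP.length-++ p))))
    at-p : suc (length p ℕ.+ 0) ≡ suc (length p)
    at-p = ≡.cong suc (ℕP.+-identityʳ (length p))
    first-f : f 0 ≡ weight ⌊ y Fin.<? x ⌋ (Q (p ∷ʳ x))
    first-f = ≡.trans (f≡ 0) (≡.trans (≡.cong (descentFactor (p ++ x ∷ y ∷ s)) at-p)
      (≡.cong₂ (λ d u → weight d (Q u)) (descentAt-mid p) (take-∷ʳ p)))
    first-g : g 0 ≡ r (p ∷ʳ x)
    first-g = ≡.trans (g≡ 0) (≡.cong r (≡.trans (≡.cong (λ j → take j (p ++ x ∷ y ∷ s)) at-p) (take-∷ʳ p)))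

  coefficient-chain : ∀ σ → length σ ≡ suc m → coefficient σ ≈ chain [] σ
  coefficient-chain (x ∷ s) length≡ = trans
    (reflexive (≡.cong₂ (λ fs gs → product fs * product gs) (reindex (descentFactor (x ∷ s))) (reindex (reciprocalFactor (x ∷ s)))))
    (chain-product [] x s (descentFactor (x ∷ s) ∘ suc) (reciprocalFactor (x ∷ s) ∘ suc) (λ _ → ≡.refl) (λ _ → ≡.refl))
    where
    reindex : ∀ (f : ℕ → Carrier) → map f (map suc (upTo m)) ≡ applyUpTo (f ∘ suc) (length s)
    reindex f = ≡.trans (≡.cong (map f) (ListP.map-upTo suc m)) (≡.trans (ListP.map-applyUpTo suc f m)
      (≡.cong (applyUpTo (f ∘ suc)) (≡.sym (ℕP.suc-injective length≡))))

  coefficient-shuffle : ∀ u z v → Unique (u ++ z ∷ reverse v) → Q (u ++ z ∷ reverse v) ≈ 1# →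
    length (u ++ z ∷ reverse v) ≡ suc m →
    coefficient (u ++ z ∷ reverse v) ≈ sign v * shuffleSum u v (λ s → coefficient (s ∷ʳ z))
  coefficient-shuffle u z v uniq Q≈1 length≡ = begin
    coefficient (u ++ z ∷ reverse v)
      ≈⟨ coefficient-chain _ length≡ ⟩
    chain [] (u ++ z ∷ reverse v)
      ≈⟨ chain-shuffle u z v uniq Q≈1 ⟩
    sign v * shuffleSum u v (λ s → chain [] (s ∷ʳ z))
      ≈⟨ *-congˡ (shuffleSum-cong u v (λ s s↭ → coefficient-chain (s ∷ʳ z) (≡.trans (↭-length (rotate s s↭)) length≡))) ⟨
    sign v * shuffleSum u v (λ s → coefficient (s ∷ʳ z)) ∎
    where
    rotate : ∀ s → s ↭ u ++ v → s ∷ʳ z ↭ u ++ z ∷ reverse v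
    rotate s s↭ = ↭-trans (++-comm s [ z ]) (↭-trans
      (Perm.prep z (↭-trans s↭ (++⁺ˡ u (↭-sym (↭-reverse v))))) (↭-sym (shift z u (reverse v))))

-- The enumeration of permutations

module _ {a} {A : Set a} where

  insertions-∈⁺ : ∀ (x : A) u v → u ++ x ∷ v ∈ insertions x (u ++ v)
  insertions-∈⁺ x []      []      = here ≡.refl
  insertions-∈⁺ x []      (y ∷ v) = here ≡.refl
  insertions-∈⁺ x (y ∷ u) v       = there (∈-map⁺ (y ∷_) (insertions-∈⁺ x u v))

  insertions-↭ : ∀ {x : A} w {z} → z ∈ insertions x w → z ↭ x ∷ w
  insertions-↭ []      (here ≡.refl) = ↭-refl
  insertions-↭ (y ∷ w) (here ≡.refl) = ↭-refl
  insertions-↭ (y ∷ w) (there z∈) with ∈-map⁻ (y ∷_) z∈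
  ... | _ , z′∈ , ≡.refl = ↭-trans (Perm.prep y (insertions-↭ w z′∈)) (Perm.swap y _ ↭-refl)

  perms-↭ : ∀ (xs : List A) {z} → z ∈ perms xs → z ↭ xs
  perms-↭ []       (here ≡.refl) = ↭-refl
  perms-↭ (x ∷ xs) z∈ with find (∈-concatMap⁻ (insertions x) z∈)
  ... | w , w∈ , z∈ins = ↭-trans (insertions-↭ w z∈ins) (Perm.prep x (perms-↭ xs w∈))

  ↭⇒∈-perms : ∀ (xs : List A) {z} → z ↭ xs → z ∈ perms xs
  ↭⇒∈-perms []       z↭ rewrite ↭-empty-inv z↭ = here ≡.refl
  ↭⇒∈-perms (x ∷ xs) z↭ with ∈-∃++ (∈-resp-↭ (↭-sym z↭) (here ≡.refl))
  ... | u , v , ≡.refl = ∈-concatMap⁺ (insertions x)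
    (lose (↭⇒∈-perms xs (drop-mid u [] z↭)) (insertions-∈⁺ x u v))

  insertions-unique : ∀ {x : A} w → x ∉ w → Unique (insertions x w)
  insertions-unique []      x∉w = [] ∷ []
  insertions-unique (y ∷ w) x∉w =
    AllP.map⁺ (All.universal (λ { _ ≡.refl → x∉w (here ≡.refl) }) _)
    ∷ UniqueP.map⁺ ListP.∷-injectiveʳ (insertions-unique w (x∉w ∘ there))

  -- As `x` occurs in neither word, its position in `z` is determined, and deleting it recovers the
  -- word.
  insertions-injective : ∀ {x : A} w w′ {z} → x ∉ w → x ∉ w′ →
    z ∈ insertions x w → z ∈ insertions x w′ → w ≡ w′
  insertions-injective []      []       x∉w x∉w′ p q = ≡.refl
  insertions-injective []      (y ∷ w′) x∉w x∉w′ (here ≡.refl) (there q) with ∈-map⁻ (y ∷_) q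
  ... | _ , _ , ≡.refl = ⊥-elim (x∉w′ (here ≡.refl))
  insertions-injective (y ∷ w) []       x∉w x∉w′ (there p) (here ≡.refl) with ∈-map⁻ (y ∷_) p
  ... | _ , _ , ≡.refl = ⊥-elim (x∉w (here ≡.refl))
  insertions-injective (y ∷ w) (y′ ∷ w′) x∉w x∉w′ (here ≡.refl) (here ≡.refl) = ≡.refl
  insertions-injective (y ∷ w) (y′ ∷ w′) x∉w x∉w′ (here ≡.refl) (there q) with ∈-map⁻ (y′ ∷_) q
  ... | _ , _ , ≡.refl = ⊥-elim (x∉w′ (here ≡.refl))
  insertions-injective (y ∷ w) (y′ ∷ w′) x∉w x∉w′ (there p) (here ≡.refl) with ∈-map⁻ (y ∷_) p
  ... | _ , _ , ≡.refl = ⊥-elim (x∉w (here ≡.refl))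
  insertions-injective (y ∷ w) (y′ ∷ w′) x∉w x∉w′ (there p) (there q)
    with ∈-map⁻ (y ∷_) p | ∈-map⁻ (y′ ∷_) q
  ... | _ , p′ , ≡.refl | _ , q′ , ≡.refl =
    ≡.cong (y ∷_) (insertions-injective w w′ (x∉w ∘ there) (x∉w′ ∘ there) p′ q′)

  -- Needed because coefficients of repeated words add up: only in a list without repetitions is the
  -- coefficient of a permutation its own weight rather than a multiple of it.
  perms-unique : ∀ {xs : List A} → Unique xs → Unique (perms xs)
  perms-unique []                   = [] ∷ []
  perms-unique {x ∷ xs} uniq@(_ ∷ u) = UniqueP.concat⁺
    (AllP.map⁺ (All.tabulate λ {w} w∈ → insertions-unique w (x∉ w∈)))
    (AllPairsP.map⁺ (pairwise (All.tabulate x∉) (perms-unique u)))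
    where
    x∉ : ∀ {w} → w ∈ perms xs → x ∉ w
    x∉ w∈ = unique-∷⇒∉ uniq ∘ ∈-resp-↭ (perms-↭ xs w∈)
    pairwise : ∀ {ws} → All (x ∉_) ws → Unique ws →
               AllPairs (λ w w′ → Disjoint (insertions x w) (insertions x w′)) ws
    pairwise []           []         = []
    pairwise (x∉w ∷ x∉ws) (w≢ ∷ uws) =
      All.zipWith (λ { (w≢w′ , x∉w′) (p , q) → w≢w′ (insertions-injective _ _ x∉w x∉w′ p q) }) (w≢ , x∉ws)
      ∷ pairwise x∉ws uws

-- Formal sums tested against functions

module Pairing {c ℓ} (R : CommutativeRing c ℓ) where
  open CommutativeRing R
  open CommutativeSemigroupProperties +-commutativeSemigroup using (interchange)
  open RingProperties ring using (-‿distribˡ-*; -0#≈0#; -‿+-comm)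
  open SetoidReasoning setoid

  module _ {a} {M : Set a} where

    -- The linear extension of `φ`, evaluated at a formal sum. Products of formal sums become
    -- iterated pairings, so no product has to be collected into normal form.
    pair : List (Carrier × M) → (M → Carrier) → Carrier
    pair []            φ = 0#
    pair ((k , e) ∷ p) φ = k * φ e + pair p φ

    pair-cong : ∀ p {φ ψ} → (∀ e → φ e ≈ ψ e) → pair p φ ≈ pair p ψ
    pair-cong []            h = refl
    pair-cong ((k , e) ∷ p) h = +-cong (*-congˡ (h e)) (pair-cong p h)

    pair-++ : ∀ p q φ → pair (p ++ q) φ ≈ pair p φ + pair q φ
    pair-++ []            q φ = sym (+-identityˡ _)
    pair-++ ((k , e) ∷ p) q φ = trans (+-congˡ (pair-++ p q φ)) (sym (+-assoc _ _ _))

    pair-scale : ∀ k p φ → pair (map (λ t → (k * proj₁ t , proj₂ t)) p) φ ≈ k * pair p φ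
    pair-scale k []            φ = sym (zeroʳ k)
    pair-scale k ((l , e) ∷ p) φ = trans (+-cong (*-assoc k l _) (pair-scale k p φ)) (sym (distribˡ k _ _))

    pair-negate : ∀ p φ → pair (map (λ t → (- proj₁ t , proj₂ t)) p) φ ≈ - pair p φ
    pair-negate []            φ = sym -0#≈0#
    pair-negate ((l , e) ∷ p) φ = trans (+-cong (sym (-‿distribˡ-* l _)) (pair-negate p φ)) (-‿+-comm _ _)

    pair-+ : ∀ p φ ψ → pair p (λ e → φ e + ψ e) ≈ pair p φ + pair p ψ
    pair-+ []            φ ψ = sym (+-identityˡ 0#)
    pair-+ ((k , e) ∷ p) φ ψ = trans (+-cong (distribˡ k _ _) (pair-+ p φ ψ)) (interchange _ _ _ _)

    pair-*ʳ : ∀ p φ k → pair p (λ e → φ e * k) ≈ pair p φ * k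
    pair-*ʳ []            φ k = sym (zeroˡ k)
    pair-*ʳ ((l , e) ∷ p) φ k = trans (+-cong (sym (*-assoc l _ k)) (pair-*ʳ p φ k)) (sym (distribʳ k _ _))

    pair-*ˡ : ∀ p φ k → pair p (λ e → k * φ e) ≈ k * pair p φ
    pair-*ˡ p φ k = trans (pair-cong p (λ e → *-comm k (φ e))) (trans (pair-*ʳ p φ k) (*-comm _ k))

    pair-0 : ∀ p → pair p (λ _ → 0#) ≈ 0#
    pair-0 []            = refl
    pair-0 ((k , e) ∷ p) = trans (+-cong (zeroʳ k) (pair-0 p)) (+-identityˡ 0#)

  pair-swap : ∀ {a b} {M : Set a} {N : Set b} (p : List (Carrier × M)) (q : List (Carrier × N)) (φ : M → N → Carrier) →
    pair p (λ e → pair q (λ f → φ e f)) ≈ pair q (λ f → pair p (λ e → φ e f))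
  pair-swap []            q φ = sym (pair-0 q)
  pair-swap ((k , e) ∷ p) q φ = trans
    (+-cong (sym (pair-*ˡ q (φ e) k)) (pair-swap p q φ))
    (sym (pair-+ q (λ f → k * φ e f) (λ f → pair p (λ e → φ e f))))

  module _ {a} {M : Set a} (_∙_ : M → M → M) where

    -- Serves both products: that of polynomials, with exponents added, and that of the free
    -- associative algebra, with words concatenated.
    convolve : List (Carrier × M) → List (Carrier × M) → List (Carrier × M)
    convolve p q = concatMap (λ t → map (λ u → (proj₁ t * proj₁ u , proj₂ t ∙ proj₂ u)) q) p

    pair-convolve : ∀ p q φ → pair (convolve p q) φ ≈ pair p (λ e → pair q (λ f → φ (e ∙ f)))
    pair-convolve []            q φ = refl
    pair-convolve ((k , e) ∷ p) q φ = trans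
      (pair-++ (map (λ u → (k * proj₁ u , e ∙ proj₂ u)) q) (convolve p q) φ)
      (+-cong (row q) (pair-convolve p q φ))
      where
      row : ∀ q → pair (map (λ u → (k * proj₁ u , e ∙ proj₂ u)) q) φ ≈ k * pair q (λ f → φ (e ∙ f))
      row []            = sym (zeroʳ k)
      row ((l , f) ∷ q) = trans (+-cong (*-assoc k l _) (row q)) (sym (distribˡ k _ _))

  module _ {a} {M : Set a} (_≟_ : DecidableEquality M) where

    opaque
      -- The Kronecker delta, which makes `pair p (δ e)` the coefficient of `e` in `p`.
      δ : M → M → Carrier
      δ e f = if does (e ≟ f) then 1# else 0#

      δ-≡ : ∀ {e f} → e ≡ f → δ e f ≈ 1#
      δ-≡ {e} {f} e≡f rewrite dec-true (e ≟ f) e≡f = refl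

      δ-≢ : ∀ {e f} → e ≢ f → δ e f ≈ 0#
      δ-≢ {e} {f} e≢f rewrite dec-false (e ≟ f) e≢f = refl

    pair-δ-≡ : ∀ {k e f} p → f ≡ e → pair ((k , f) ∷ p) (δ e) ≈ k + pair p (δ e)
    pair-δ-≡ p f≡e = +-congʳ (trans (*-congˡ (δ-≡ (≡.sym f≡e))) (*-identityʳ _))

    pair-δ-≢ : ∀ {k e f} p → f ≢ e → pair ((k , f) ∷ p) (δ e) ≈ pair p (δ e)
    pair-δ-≢ p f≢e = trans (+-congʳ (trans (*-congˡ (δ-≢ (f≢e ∘ ≡.sym))) (zeroʳ _))) (+-identityˡ _)

  δ-cong : ∀ {a b} {M : Set a} {N : Set b} (_≟_ : DecidableEquality M) (_≟′_ : DecidableEquality N) {e f e′ f′} →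
    (e ≡ f → e′ ≡ f′) → (e′ ≡ f′ → e ≡ f) → δ _≟_ e f ≈ δ _≟′_ e′ f′
  δ-cong _≟_ _≟′_ {e} {f} to from with e ≟ f
  ... | yes e≡f = trans (δ-≡ _≟_ e≡f) (sym (δ-≡ _≟′_ (to e≡f)))
  ... | no  e≢f = trans (δ-≢ _≟_ e≢f) (sym (δ-≢ _≟′_ (e≢f ∘ from)))

  δ-× : ∀ {a b d} {M : Set a} {N : Set b} {P : Set d} (_≟_ : DecidableEquality M) (_≟′_ : DecidableEquality N)
    (_≟″_ : DecidableEquality P) {e f e′ f′ e″ f″} →
    (e ≡ f → e′ ≡ f′ × e″ ≡ f″) → (e′ ≡ f′ → e″ ≡ f″ → e ≡ f) →
    δ _≟_ e f ≈ δ _≟′_ e′ f′ * δ _≟″_ e″ f″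
  δ-× _≟_ _≟′_ _≟″_ {e} {f} {e′} {f′} {e″} {f″} to from with e ≟ f
  ... | yes e≡f = trans (δ-≡ _≟_ e≡f)
    (sym (trans (*-cong (δ-≡ _≟′_ (proj₁ (to e≡f))) (δ-≡ _≟″_ (proj₂ (to e≡f)))) (*-identityˡ 1#)))
  ... | no  e≢f with e′ ≟′ f′
  ...   | yes e′≡f′ = trans (δ-≢ _≟_ e≢f) (sym (trans (*-congˡ (δ-≢ _≟″_ (e≢f ∘ from e′≡f′))) (zeroʳ _)))
  ...   | no  e′≢f′ = trans (δ-≢ _≟_ e≢f) (sym (trans (*-congʳ (δ-≢ _≟′_ e′≢f′)) (zeroˡ _)))

  module _ {a} {M : Set a} (w : M → Carrier) where

    weighted : List M → List (Carrier × M)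
    weighted = map (λ t → (w t , t))

    pair-weighted-cong : ∀ ts {φ ψ} → (∀ {t} → t ∈ ts → φ t ≈ ψ t) → pair (weighted ts) φ ≈ pair (weighted ts) ψ
    pair-weighted-cong []       h = refl
    pair-weighted-cong (t ∷ ts) h = +-cong (*-congˡ (h (here ≡.refl))) (pair-weighted-cong ts (h ∘ there))

    module _ (_≟_ : DecidableEquality M) where

      pair-weighted-δ-∉ : ∀ {s} ts → s ∉ ts → pair (weighted ts) (δ _≟_ s) ≈ 0#
      pair-weighted-δ-∉ []       s∉ = refl
      pair-weighted-δ-∉ (t ∷ ts) s∉ = trans
        (pair-δ-≢ _≟_ (weighted ts) (s∉ ∘ here ∘ ≡.sym)) (pair-weighted-δ-∉ ts (s∉ ∘ there))

      pair-weighted-δ-∈ : ∀ {s ts} → Unique ts → s ∈ ts → pair (weighted ts) (δ _≟_ s) ≈ w s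
      pair-weighted-δ-∈ {s} {t ∷ ts} uniq (here ≡.refl) = trans
        (pair-δ-≡ _≟_ (weighted ts) ≡.refl)
        (trans (+-congˡ (pair-weighted-δ-∉ ts (unique-∷⇒∉ uniq))) (+-identityʳ _))
      pair-weighted-δ-∈ {s} {t ∷ ts} uniq@(_ ∷ uts) (there s∈) = trans
        (pair-δ-≢ _≟_ (weighted ts) λ { ≡.refl → unique-∷⇒∉ uniq s∈ }) (pair-weighted-δ-∈ uts s∈)

-- Right-normed brackets and their coefficients

module RightNormed {a c ℓ} {A : Set a} (R : CommutativeRing c ℓ) (_≟_ : DecidableEquality A) where
  open CommutativeRing R
  open RingProperties ring using (-‿distribˡ-*; -1*x≈-x; -0#≈0#; -‿involutive)
  open Pairing R
  open ShuffleSum {A = A} R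
  open SetoidReasoning setoid

  _≟*_ : DecidableEquality (List A)
  _≟*_ = ListP.≡-dec _≟_

  letter : A → List (Carrier × List A)
  letter x = [ (1# , [ x ]) ]

  bracket : List (Carrier × List A) → List (Carrier × List A) → List (Carrier × List A)
  bracket p q = convolve _++_ p q ++ map (λ t → (- 1# * proj₁ t , proj₂ t)) (convolve _++_ q p)

  pair-bracket-letter : ∀ x p φ → pair (bracket (letter x) p) φ ≈ pair p (φ ∘ (x ∷_)) - pair p (φ ∘ (_∷ʳ x))
  pair-bracket-letter x p φ = trans (pair-++ (convolve _++_ (letter x) p) _ φ) (+-cong
    (trans (pair-convolve _++_ (letter x) p φ) (trans (+-identityʳ _) (*-identityˡ _)))
    (trans (pair-scale (- 1#) (convolve _++_ p (letter x)) φ) (trans (-1*x≈-x _) (-‿cong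
      (trans (pair-convolve _++_ p (letter x) φ)
        (pair-cong p (λ e → trans (+-identityʳ _) (*-identityˡ _))))))))

  rightNormed : A → List A → List (Carrier × List A)
  rightNormed z []      = letter z
  rightNormed z (x ∷ t) = bracket (letter x) (rightNormed z t)

  pair-rightNormed-0 : ∀ z t {φ} → (∀ w → z ∈ w → φ w ≈ 0#) → pair (rightNormed z t) φ ≈ 0#
  pair-rightNormed-0 z []      h = trans (+-identityʳ _) (trans (*-identityˡ _) (h [ z ] (here ≡.refl)))
  pair-rightNormed-0 z (x ∷ t) {φ} h = begin
    pair (rightNormed z (x ∷ t)) φ
      ≈⟨ pair-bracket-letter x (rightNormed z t) φ ⟩
    pair (rightNormed z t) (φ ∘ (x ∷_)) - pair (rightNormed z t) (φ ∘ (_∷ʳ x))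
      ≈⟨ +-cong (pair-rightNormed-0 z t (λ w z∈w → h _ (there z∈w)))
                (-‿cong (pair-rightNormed-0 z t (λ w z∈w → h _ (∈-++⁺ˡ z∈w)))) ⟩
    0# - 0#
      ≈⟨ -‿inverseʳ 0# ⟩
    0# ∎

  private
    δ* = δ _≟*_
    δ¹ = δ _≟_

    -- The two origins of the first letter of a shuffle equal to `x ∷ t`: it is the head of `u` or
    -- the head of `v`. The names refer to the word `u ++ z ∷ reverse v`, in which the head of `v`
    -- comes last.
    startingWith endingWith : A → List A → List A → List A → Carrier
    startingWith x t []      v = 0#
    startingWith x t (b ∷ u) v = shuffleSum u v (δ* t) * δ¹ b x
    endingWith x t u []      = 0#
    endingWith x t u (b ∷ v) = shuffleSum u v (δ* t) * δ¹ b x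

    δ*-∷ : ∀ {x t b s} → δ* (x ∷ t) (b ∷ s) ≈ δ* t s * δ¹ b x
    δ*-∷ = δ-× _≟*_ _≟*_ _≟_ (λ eq → ListP.∷-injectiveʳ eq , ≡.sym (ListP.∷-injectiveˡ eq))
      (λ { ≡.refl ≡.refl → ≡.refl })

    δ*-∷ʳ : ∀ {x t b s} → δ* (s ∷ʳ b) (t ∷ʳ x) ≈ δ* s t * δ¹ b x
    δ*-∷ʳ {x} {t} {b} {s} = δ-× _≟*_ _≟*_ _≟_ (ListP.∷ʳ-injective s t) (λ { ≡.refl ≡.refl → ≡.refl })

    shuffleSum-δ*-∷ : ∀ u v x t b → shuffleSum u v (δ* (x ∷ t) ∘ (b ∷_)) ≈ shuffleSum u v (δ* t) * δ¹ b x
    shuffleSum-δ*-∷ u v x t b = trans (shuffleSum-cong u v (λ s _ → δ*-∷)) (shuffleSum-*ʳ u v _ _)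

    shuffleSum-first : ∀ u v x t → shuffleSum u v (δ* (x ∷ t)) ≈ startingWith x t u v + endingWith x t u v
    shuffleSum-first []      []      x t = trans (δ-≢ _≟*_ (λ ())) (sym (+-identityˡ 0#))
    shuffleSum-first []      (b ∷ v) x t = trans δ*-∷ (sym (+-identityˡ _))
    shuffleSum-first (b ∷ u) []      x t = trans δ*-∷
      (trans (*-congʳ (sym (shuffleSum-[]ʳ u _))) (sym (+-identityʳ _)))
    shuffleSum-first (b ∷ u) (b′ ∷ v) x t =
      +-cong (shuffleSum-δ*-∷ u (b′ ∷ v) x t b) (shuffleSum-δ*-∷ (b ∷ u) v x t b′)

  -- The outermost letter `x` of the bracket is either the first letter of the word, hence the head
  -- of `u`, or the last one with a minus sign, hence the head of `v`. This is the recursion of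
  -- shuffles on their first letter, with one sign for each letter taken from `v`. Since `x` differs
  -- from `z`, it cannot be matched with `z` when `u` or `v` is empty.
  rightNormed-coefficient : ∀ z t → z ∉ t → ∀ u v →
    pair (rightNormed z t) (δ* (u ++ z ∷ reverse v)) ≈ sign v * shuffleSum u v (δ* t)
  rightNormed-coefficient z [] z∉t u v = trans (+-identityʳ _) (trans (*-identityˡ _) (base u v))
    where
    base : ∀ u v → δ* (u ++ z ∷ reverse v) [ z ] ≈ sign v * shuffleSum u v (δ* [])
    base []      []      = trans (δ-≡ _≟*_ ≡.refl) (sym (trans (*-identityˡ _) (δ-≡ _≟*_ ≡.refl)))
    base []      (y ∷ v) = trans (δ-≢ _≟*_ (reverse≢[] ∘ ListP.∷-injectiveʳ))
      (sym (trans (*-congˡ (δ-≢ _≟*_ (λ ()))) (zeroʳ _)))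
      where
      reverse≢[] : reverse (y ∷ v) ≢ []
      reverse≢[] eq with () ← ≡.trans (≡.sym (ListP.reverse-involutive (y ∷ v))) (≡.cong reverse eq)
    base (x ∷ u) v       = trans (δ-≢ _≟*_ (∷≢[] u ∘ ListP.∷-injectiveʳ))
      (sym (trans (*-congˡ (trans (shuffleSum-cong (x ∷ u) v (λ s p → δ-≢ _≟*_ λ { ≡.refl →
          ∉[] (∈-resp-↭ (↭-sym p) (here ≡.refl)) }))
        (shuffleSum-0 (x ∷ u) v))) (zeroʳ _)))
      where
      ∷≢[] : ∀ u → u ++ z ∷ reverse v ≢ []
      ∷≢[] []      ()
      ∷≢[] (_ ∷ _) ()
      ∉[] : x ∉ []
      ∉[] ()
  rightNormed-coefficient z (x ∷ t) z∉t u v = begin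
    pair (rightNormed z (x ∷ t)) (δ* (u ++ z ∷ reverse v))
      ≈⟨ pair-bracket-letter x N _ ⟩
    pair N (δ* (u ++ z ∷ reverse v) ∘ (x ∷_)) - pair N (δ* (u ++ z ∷ reverse v) ∘ (_∷ʳ x))
      ≈⟨ +-cong (left u) (trans (-‿cong (right v)) (-‿involutive _)) ⟩
    sign v * startingWith x t u v + sign v * endingWith x t u v
      ≈⟨ distribˡ _ _ _ ⟨
    sign v * (startingWith x t u v + endingWith x t u v)
      ≈⟨ *-congˡ (shuffleSum-first u v x t) ⟨
    sign v * shuffleSum u v (δ* (x ∷ t)) ∎
    where
    N = rightNormed z t
    z≢x : z ≢ x
    z≢x = z∉t ∘ here
    left : ∀ u → pair N (δ* (u ++ z ∷ reverse v) ∘ (x ∷_)) ≈ sign v * startingWith x t u v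
    left []      = trans (pair-cong N (λ s → δ-≢ _≟*_ (z≢x ∘ ListP.∷-injectiveˡ))) (trans (pair-0 N) (sym (zeroʳ _)))
    left (b ∷ u) = begin
      pair N (δ* (b ∷ u ++ z ∷ reverse v) ∘ (x ∷_))
        ≈⟨ pair-cong N (λ s → trans δ*-∷ (*-congˡ (δ-cong _≟_ _≟_ ≡.sym ≡.sym))) ⟩
      pair N (λ s → δ* (u ++ z ∷ reverse v) s * δ¹ b x)
        ≈⟨ pair-*ʳ N _ _ ⟩
      pair N (δ* (u ++ z ∷ reverse v)) * δ¹ b x
        ≈⟨ *-congʳ (rightNormed-coefficient z t (z∉t ∘ there) u v) ⟩
      (sign v * shuffleSum u v (δ* t)) * δ¹ b x
        ≈⟨ *-assoc _ _ _ ⟩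
      sign v * (shuffleSum u v (δ* t) * δ¹ b x) ∎
    right : ∀ v → pair N (δ* (u ++ z ∷ reverse v) ∘ (_∷ʳ x)) ≈ - (sign v * endingWith x t u v)
    right []      = begin
      pair N (δ* (u ∷ʳ z) ∘ (_∷ʳ x))
        ≈⟨ pair-cong N (λ s → δ-≢ _≟*_ (z≢x ∘ ListP.∷ʳ-injectiveʳ u s)) ⟩
      pair N (λ _ → 0#)
        ≈⟨ pair-0 N ⟩
      0#
        ≈⟨ trans (-‿cong (zeroʳ _)) -0#≈0# ⟨
      - (1# * 0#) ∎
    right (b ∷ v) = begin
      pair N (δ* (u ++ z ∷ reverse (b ∷ v)) ∘ (_∷ʳ x))
        ≡⟨ ≡.cong (λ w → pair N (δ* w ∘ (_∷ʳ x)))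
             (≡.trans (≡.cong (λ w → u ++ z ∷ w) (ListP.unfold-reverse b v)) (≡.sym (ListP.++-assoc u (z ∷ reverse v) [ b ]))) ⟩
      pair N (δ* ((u ++ z ∷ reverse v) ∷ʳ b) ∘ (_∷ʳ x))
        ≈⟨ pair-cong N (λ s → δ*-∷ʳ) ⟩
      pair N (λ s → δ* (u ++ z ∷ reverse v) s * δ¹ b x)
        ≈⟨ pair-*ʳ N _ _ ⟩
      pair N (δ* (u ++ z ∷ reverse v)) * δ¹ b x
        ≈⟨ *-congʳ (rightNormed-coefficient z t (z∉t ∘ there) u v) ⟩
      (sign v * shuffleSum u v (δ* t)) * δ¹ b x
        ≈⟨ *-assoc _ _ _ ⟩
      sign v * endingWith x t u (b ∷ v)
        ≈⟨ -‿involutive _ ⟨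
      - - (sign v * endingWith x t u (b ∷ v))
        ≈⟨ -‿cong (-‿distribˡ-* _ _) ⟩
      - (- sign v * endingWith x t u (b ∷ v)) ∎

  pair-shuffleSum : ∀ {b} {M : Set b} (p : List (Carrier × M)) u v (φ : M → List A → Carrier) →
    pair p (λ t → shuffleSum u v (φ t)) ≈ shuffleSum u v (λ s → pair p (λ t → φ t s))
  pair-shuffleSum p []      v       φ = refl
  pair-shuffleSum p (x ∷ u) []      φ = refl
  pair-shuffleSum p (x ∷ u) (y ∷ v) φ = trans (pair-+ p _ _)
    (+-cong (pair-shuffleSum p u (y ∷ v) _) (pair-shuffleSum p (x ∷ u) v _))

-- The expansion into right-normed brackets

module LieExpansion {c ℓ} (R : CommutativeRing c ℓ) {n : ℕ}
  (coefficient : List (Fin n) → CommutativeRing.Carrier R) where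
  open CommutativeRing R
  open ShuffleSum {A = Fin n} R
  open RightNormed R (Fin._≟_ {n})
  open Pairing R
  open SetoidReasoning setoid

  expansion : Fin n → List (List (Fin n)) → List (Carrier × List (Fin n))
  expansion z = concatMap (λ t → map (λ s → (coefficient (t ∷ʳ z) * proj₁ s , proj₂ s)) (rightNormed z t))

  pair-expansion : ∀ z ts φ → pair (expansion z ts) φ ≈
    pair (weighted (λ t → coefficient (t ∷ʳ z)) ts) (λ t → pair (rightNormed z t) φ)
  pair-expansion z []       φ = refl
  pair-expansion z (t ∷ ts) φ = trans
    (pair-++ (map _ (rightNormed z t)) (expansion z ts) φ)
    (+-cong (pair-scale _ (rightNormed z t) φ) (pair-expansion z ts φ))

  -- Summing over `t` makes the shuffle multiplicities select each shuffle `s` with weight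
  -- `coefficient (s ∷ʳ z)`, so the coefficient of the expansion is the right side of the shuffle
  -- hypothesis. Equality in the free algebra concerns all words, so those without `z` and those
  -- with the wrong letters are shown to have coefficient 0 on both sides.
  expansion-coefficient : ∀ {z xs} → Unique (z ∷ xs) →
    (∀ u v → u ++ z ∷ reverse v ↭ z ∷ xs →
      coefficient (u ++ z ∷ reverse v) ≈ sign v * shuffleSum u v (λ s → coefficient (s ∷ʳ z))) →
    ∀ w → pair (expansion z (perms xs)) (δ _≟*_ w) ≈ pair (weighted coefficient (perms (z ∷ xs))) (δ _≟*_ w)
  expansion-coefficient {z} {xs} uniq@(_ ∷ uniq-xs) coefficient-shuffle w =
    trans (pair-expansion z (perms xs) (δ _≟*_ w)) (by-z∈w (z ∈? w))
    where
    open DecMembership (Fin._≟_ {n}) using (_∈?_)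
    open DecMembership _≟*_ using () renaming (_∈?_ to _∈*?_)
    A = weighted (λ t → coefficient (t ∷ʳ z)) (perms xs)
    E = weighted coefficient (perms (z ∷ xs))

    z∉xs : z ∉ xs
    z∉xs = unique-∷⇒∉ uniq

    expanded : ∀ u v → pair A (λ t → pair (rightNormed z t) (δ _≟*_ (u ++ z ∷ reverse v)))
      ≈ sign v * shuffleSum u v (λ s → pair A (δ _≟*_ s))
    expanded u v = begin
      pair A (λ t → pair (rightNormed z t) (δ _≟*_ (u ++ z ∷ reverse v)))
        ≈⟨ pair-weighted-cong _ (perms xs) (λ {t} t∈ →
             rightNormed-coefficient z t (z∉xs ∘ ∈-resp-↭ (perms-↭ xs t∈)) u v) ⟩
      pair A (λ t → sign v * shuffleSum u v (δ _≟*_ t))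
        ≈⟨ pair-*ˡ A _ (sign v) ⟩
      sign v * pair A (λ t → shuffleSum u v (δ _≟*_ t))
        ≈⟨ *-congˡ (pair-shuffleSum A u v (δ _≟*_)) ⟩
      sign v * shuffleSum u v (λ s → pair A (λ t → δ _≟*_ t s))
        ≈⟨ *-congˡ (shuffleSum-cong u v (λ s _ → pair-cong A (λ t → δ-cong _≟*_ _≟*_ ≡.sym ≡.sym))) ⟩
      sign v * shuffleSum u v (λ s → pair A (δ _≟*_ s)) ∎

    by-z∈w : Dec (z ∈ w) → pair A (λ t → pair (rightNormed z t) (δ _≟*_ w)) ≈ pair E (δ _≟*_ w)
    by-z∈w (no z∉w) = begin
      pair A (λ t → pair (rightNormed z t) (δ _≟*_ w))
        ≈⟨ pair-cong A (λ t → pair-rightNormed-0 z t (λ s z∈s → δ-≢ _≟*_ λ { ≡.refl → z∉w z∈s })) ⟩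
      pair A (λ _ → 0#)
        ≈⟨ pair-0 A ⟩
      0#
        ≈⟨ pair-weighted-δ-∉ coefficient _≟*_ (perms (z ∷ xs))
             (λ w∈ → z∉w (∈-resp-↭ (↭-sym (perms-↭ (z ∷ xs) w∈)) (here ≡.refl))) ⟨
      pair E (δ _≟*_ w) ∎
    by-z∈w (yes z∈w) with ∈-∃++ z∈w
    -- The tail behind `z` is written as the reversal of its own reversal `v`, the form required by
    -- `rightNormed-coefficient`.
    ... | u , w′ , ≡.refl with reverse w′ | ListP.reverse-involutive w′
    ...   | v | ≡.refl = trans (expanded u v) (by-w∈perms (u ++ z ∷ reverse v ∈*? perms (z ∷ xs)))
      where
      uv↭ : u ++ v ↭ u ++ reverse v
      uv↭ = ++⁺ˡ u (↭-sym (↭-reverse v))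
      by-w∈perms : Dec (u ++ z ∷ reverse v ∈ perms (z ∷ xs)) →
        sign v * shuffleSum u v (λ s → pair A (δ _≟*_ s)) ≈ pair E (δ _≟*_ (u ++ z ∷ reverse v))
      by-w∈perms (yes w∈) = begin
        sign v * shuffleSum u v (λ s → pair A (δ _≟*_ s))
          ≈⟨ *-congˡ (shuffleSum-cong u v (λ s p → pair-weighted-δ-∈ _ _≟*_ (perms-unique uniq-xs)
               (↭⇒∈-perms xs (↭-trans p (↭-trans uv↭ (drop-mid u [] w↭)))))) ⟩
        sign v * shuffleSum u v (λ s → coefficient (s ∷ʳ z))
          ≈⟨ coefficient-shuffle u v w↭ ⟨
        coefficient (u ++ z ∷ reverse v)
          ≈⟨ pair-weighted-δ-∈ coefficient _≟*_ (perms-unique uniq) w∈ ⟨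
        pair E (δ _≟*_ (u ++ z ∷ reverse v)) ∎
        where
        w↭ : u ++ z ∷ reverse v ↭ z ∷ xs
        w↭ = perms-↭ (z ∷ xs) w∈
      by-w∈perms (no w∉) = begin
        sign v * shuffleSum u v (λ s → pair A (δ _≟*_ s))
          ≈⟨ *-congˡ (shuffleSum-cong u v (λ s p → pair-weighted-δ-∉ _ _≟*_ (perms xs) (λ s∈ →
               w∉ (↭⇒∈-perms (z ∷ xs) (↭-trans (shift z u (reverse v)) (Perm.prep z
                 (↭-trans (↭-sym uv↭) (↭-trans (↭-sym p) (perms-↭ xs s∈))))))))) ⟩
        sign v * shuffleSum u v (λ _ → 0#)
          ≈⟨ trans (*-congˡ (shuffleSum-0 u v)) (zeroʳ _) ⟩
        0#
          ≈⟨ pair-weighted-δ-∉ coefficient _≟*_ (perms (z ∷ xs)) w∉ ⟨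
        pair E (δ _≟*_ (u ++ z ∷ reverse v)) ∎

-- From coefficients to arbitrary test functions

module PairingSupport {a c ℓ} (R : CommutativeRing c ℓ) {M : Set a} (_≟_ : DecidableEquality M) where
  open CommutativeRing R
  open Pairing R
  open NaturalCoefficients commutativeSemiring using (solve; _:=_; _:+_; _:*_; con)
  open SetoidReasoning setoid

  private
    Support = List (Carrier × M)

    remove : M → Support → Support
    remove e = filter (λ t → ¬? (proj₂ t ≟ e))

  pair-remove : ∀ e p φ → pair p φ ≈ pair p (δ _≟_ e) * φ e + pair (remove e p) φ
  pair-remove e []            φ = sym (trans (+-identityʳ _) (zeroˡ _))
  pair-remove e ((k , f) ∷ p) φ with f ≟ e
  ... | yes ≡.refl = begin
    k * φ e + pair p φ
      ≈⟨ +-congˡ (pair-remove e p φ) ⟩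
    k * φ e + (pair p (δ _≟_ e) * φ e + pair (remove e p) φ)
      ≈⟨ solve 4 (λ k x y z → k :* x :+ (y :* x :+ z) := (k :* con 1 :+ y) :* x :+ z) refl k _ _ _ ⟩
    (k * 1# + pair p (δ _≟_ e)) * φ e + pair (remove e p) φ
      ≈⟨ +-congʳ (*-congʳ (+-congʳ (*-congˡ (δ-≡ _≟_ ≡.refl)))) ⟨
    (k * δ _≟_ e e + pair p (δ _≟_ e)) * φ e + pair (remove e p) φ ∎
  ... | no f≢e = begin
    k * φ f + pair p φ
      ≈⟨ +-congˡ (pair-remove e p φ) ⟩
    k * φ f + (pair p (δ _≟_ e) * φ e + pair (remove e p) φ)
      ≈⟨ solve 5 (λ k x y z w → k :* w :+ (y :* x :+ z) := (k :* con 0 :+ y) :* x :+ (k :* w :+ z)) refl k _ _ _ _ ⟩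
    (k * 0# + pair p (δ _≟_ e)) * φ e + (k * φ f + pair (remove e p) φ)
      ≈⟨ +-congʳ (*-congʳ (+-congʳ (*-congˡ (δ-≢ _≟_ (f≢e ∘ ≡.sym))))) ⟨
    (k * δ _≟_ e f + pair p (δ _≟_ e)) * φ e + (k * φ f + pair (remove e p) φ) ∎

  -- A formal sum may list a basis element several times, with coefficients that cancel only
  -- together. All terms at the first listed element are therefore removed at once; their total is
  -- 0, so no pairing changes, and the list gets shorter.
  pair-vanishes : ∀ p → (∀ e → pair p (δ _≟_ e) ≈ 0#) → ∀ φ → pair p φ ≈ 0#
  pair-vanishes p = go p (<-wellFounded (length p))
    where
    go : ∀ p → Acc ℕ._<_ (length p) → (∀ e → pair p (δ _≟_ e) ≈ 0#) → ∀ φ → pair p φ ≈ 0#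
    go []              _        h φ = refl
    go p@((_ , e) ∷ _) (acc rs) h φ = trans (split φ)
      (go (remove e p) (rs (ListP.filter-notAll (λ t → ¬? (proj₂ t ≟ e)) p (here λ e≢e → e≢e ≡.refl)))
        (λ f → trans (sym (split (δ _≟_ f))) (h f)) φ)
      where
      split : ∀ ψ → pair p ψ ≈ pair (remove e p) ψ
      split ψ = trans (pair-remove e p ψ) (trans (+-congʳ (trans (*-congʳ (h e)) (zeroˡ _))) (+-identityˡ _))

-- The ring of fractions with cancellable denominators

module Localization {c ℓ} (P : CommutativeRing c ℓ) where
  open CommutativeRing P
  open RingProperties ring using (-‿distribˡ-*)
  open NaturalCoefficients commutativeSemiring using (solve; _:=_; _:+_; _:*_; con)
  open SetoidReasoning setoid

  -- Being nonzero does not suffice: transitivity of cross-multiplication cancels the middle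
  -- denominator, which must therefore be a non-zero-divisor.
  Regular : Carrier → Set (c ⊔ ℓ)
  Regular d = ∀ p → p * d ≈ 0# → p ≈ 0#

  regular-1 : Regular 1#
  regular-1 p p1≈0 = trans (sym (*-identityʳ p)) p1≈0

  regular-* : ∀ {d e} → Regular d → Regular e → Regular (d * e)
  regular-* reg-d reg-e p pde≈0 = reg-d p (reg-e _ (trans (*-assoc p _ _) pde≈0))

  regular-cancel : ∀ {d} → Regular d → ∀ {p q} → p * d ≈ q * d → p ≈ q
  regular-cancel {d} reg {p} {q} pd≈qd = GroupProperties.x∙y⁻¹≈ε⇒x≈y +-group p q (reg (p - q) (begin
    (p - q) * d         ≈⟨ distribʳ d p (- q) ⟩
    p * d + (- q) * d   ≈⟨ +-cong pd≈qd (sym (-‿distribˡ-* q d)) ⟩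
    q * d - q * d       ≈⟨ -‿inverseʳ (q * d) ⟩
    0#                  ∎))

  record Fraction : Set (c ⊔ ℓ) where
    constructor fraction
    field
      numerator denominator : Carrier
      regular : Regular denominator
  open Fraction public

  infix 4 _≃_
  _≃_ : Fraction → Fraction → Set ℓ
  x ≃ y = numerator x * denominator y ≈ numerator y * denominator x

  infixl 6 _+F_
  infixl 7 _*F_
  _+F_ _*F_ : Fraction → Fraction → Fraction
  fraction a b rb +F fraction c d rd = fraction (a * d + c * b) (b * d) (regular-* rb rd)
  fraction a b rb *F fraction c d rd = fraction (a * c) (b * d) (regular-* rb rd)

  -F_ : Fraction → Fraction
  -F fraction a b rb = fraction (- a) b rb

  0F 1F : Fraction
  0F = fraction 0# 1# regular-1
  1F = fraction 1# 1# regular-1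

  ≃-trans : ∀ {x y z} → x ≃ y → y ≃ z → x ≃ z
  ≃-trans {fraction a b _} {fraction c d rd} {fraction e f _} ad≈cb cf≈ed = regular-cancel rd (begin
    a * f * d   ≈⟨ solve 3 (λ a f d → a :* f :* d := a :* d :* f) refl a f d ⟩
    a * d * f   ≈⟨ *-congʳ ad≈cb ⟩
    c * b * f   ≈⟨ solve 3 (λ c b f → c :* b :* f := c :* f :* b) refl c b f ⟩
    c * f * b   ≈⟨ *-congʳ cf≈ed ⟩
    e * d * b   ≈⟨ solve 3 (λ e d b → e :* d :* b := e :* b :* d) refl e d b ⟩
    e * b * d   ∎)

  fractions-isCommutativeRing : IsCommutativeRing _≃_ _+F_ _*F_ -F_ 0F 1F
  fractions-isCommutativeRing = record
    { isRing = record
      { +-isAbelianGroup = record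
        { isGroup = record
          { isMonoid = record
            { isSemigroup = record
              { isMagma = record
                { isEquivalence = record
                  { refl = refl
                  ; sym = sym
                  ; trans = λ {x} {y} {z} → ≃-trans {x} {y} {z}
                  }
                ; ∙-cong = λ {x} {y} {u} {v} → +F-cong {x} {y} {u} {v}
                }
              ; assoc = λ (fraction a b _) (fraction c d _) (fraction e f _) → solve 6 (λ a b c d e f →
                  ((a :* d :+ c :* b) :* f :+ e :* (b :* d)) :* (b :* (d :* f))
                  := (a :* (d :* f) :+ (c :* f :+ e :* d) :* b) :* ((b :* d) :* f)) refl a b c d e f
              }
            ; identity = (λ (fraction a b _) → solve 2 (λ a b →
                (con 0 :* b :+ a :* con 1) :* b := a :* (con 1 :* b)) refl a b)
              , (λ (fraction a b _) → solve 2 (λ a b →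
                (a :* con 1 :+ con 0 :* b) :* b := a :* (b :* con 1)) refl a b)
            }
          ; inverse = (λ (fraction a b _) → negation-inverse (-‿inverseˡ a) b) , (λ (fraction a b _) → negation-inverse (-‿inverseʳ a) b)
          ; ⁻¹-cong = λ {x} {y} eq → trans (sym (-‿distribˡ-* _ _)) (trans (-‿cong eq) (-‿distribˡ-* _ _))
          }
        ; comm = λ (fraction a b _) (fraction c d _) → solve 4 (λ a b c d →
            (a :* d :+ c :* b) :* (d :* b) := (c :* b :+ a :* d) :* (b :* d)) refl a b c d
        }
      ; *-cong = λ {x} {y} {u} {v} → *F-cong {x} {y} {u} {v}
      ; *-assoc = λ (fraction a b _) (fraction c d _) (fraction e f _) → solve 6 (λ a b c d e f →
          (a :* c :* e) :* (b :* (d :* f)) := (a :* (c :* e)) :* (b :* d :* f)) refl a b c d e f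
      ; *-identity = (λ (fraction a b _) → solve 2 (λ a b → (con 1 :* a) :* b := a :* (con 1 :* b)) refl a b)
          , (λ (fraction a b _) → solve 2 (λ a b → (a :* con 1) :* b := a :* (b :* con 1)) refl a b)
      ; distrib = (λ (fraction a b _) (fraction c d _) (fraction e f _) → solve 6 (λ a b c d e f →
          (a :* (c :* f :+ e :* d)) :* ((b :* d) :* (b :* f))
          := ((a :* c) :* (b :* f) :+ (a :* e) :* (b :* d)) :* (b :* (d :* f))) refl a b c d e f)
          , (λ (fraction a b _) (fraction c d _) (fraction e f _) → solve 6 (λ a b c d e f →
          ((c :* f :+ e :* d) :* a) :* ((d :* b) :* (f :* b))
          := ((c :* a) :* (f :* b) :+ (e :* a) :* (d :* b)) :* ((d :* f) :* b)) refl a b c d e f)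
      }
    ; *-comm = λ (fraction a b _) (fraction c d _) → solve 4 (λ a b c d →
        (a :* c) :* (d :* b) := (c :* a) :* (b :* d)) refl a b c d
    }
    where
    +F-cong : ∀ {x y u v} → x ≃ y → u ≃ v → x +F u ≃ y +F v
    +F-cong {fraction a b _} {fraction a′ b′ _} {fraction c d _} {fraction c′ d′ _} ab′ cd′ = begin
      (a * d + c * b) * (b′ * d′)
        ≈⟨ solve 6 (λ a b c d b′ d′ →
             (a :* d :+ c :* b) :* (b′ :* d′) := (a :* b′) :* (d :* d′) :+ (c :* d′) :* (b :* b′)) refl a b c d b′ d′ ⟩
      (a * b′) * (d * d′) + (c * d′) * (b * b′)
        ≈⟨ +-cong (*-congʳ ab′) (*-congʳ cd′) ⟩
      (a′ * b) * (d * d′) + (c′ * d) * (b * b′)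
        ≈⟨ solve 6 (λ a′ b c′ d b′ d′ →
             (a′ :* b) :* (d :* d′) :+ (c′ :* d) :* (b :* b′) := (a′ :* d′ :+ c′ :* b′) :* (b :* d)) refl a′ b c′ d b′ d′ ⟩
      (a′ * d′ + c′ * b′) * (b * d) ∎
    *F-cong : ∀ {x y u v} → x ≃ y → u ≃ v → x *F u ≃ y *F v
    *F-cong {fraction a b _} {fraction a′ b′ _} {fraction c d _} {fraction c′ d′ _} ab′ cd′ = begin
      (a * c) * (b′ * d′)  ≈⟨ solve 4 (λ a c b′ d′ → (a :* c) :* (b′ :* d′) := (a :* b′) :* (c :* d′)) refl a c b′ d′ ⟩
      (a * b′) * (c * d′)  ≈⟨ *-cong ab′ cd′ ⟩
      (a′ * b) * (c′ * d)  ≈⟨ solve 4 (λ a′ b c′ d → (a′ :* b) :* (c′ :* d) := (a′ :* c′) :* (b :* d)) refl a′ b c′ d ⟩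
      (a′ * c′) * (b * d)  ∎
    negation-inverse : ∀ {s t} → s + t ≈ 0# → ∀ b → (s * b + t * b) * 1# ≈ 0# * (b * b)
    negation-inverse {s} {t} s+t≈0 b = begin
      (s * b + t * b) * 1#  ≈⟨ trans (*-identityʳ _) (sym (distribʳ b s t)) ⟩
      (s + t) * b           ≈⟨ *-congʳ s+t≈0 ⟩
      0# * b                ≈⟨ trans (zeroˡ b) (sym (zeroˡ _)) ⟩
      0# * (b * b)          ∎

  localization : CommutativeRing (c ⊔ ℓ) ℓ
  localization = record { isCommutativeRing = fractions-isCommutativeRing }

-- Polynomials, and the regularity of monomials and binomials

infixl 6 _⊕_
_⊕_ : ∀ {m} → Vec ℕ m → Vec ℕ m → Vec ℕ m
_⊕_ = zipWith ℕ._+_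

⊕-cancelʳ : ∀ {m} (e f a : Vec ℕ m) → e ⊕ a ≡ f ⊕ a → e ≡ f
⊕-cancelʳ []      []      []      eq = ≡.refl
⊕-cancelʳ (x ∷ e) (y ∷ f) (z ∷ a) eq = ≡.cong₂ _∷_
  (ℕP.+-cancelʳ-≡ z x y (VecP.∷-injectiveˡ eq)) (⊕-cancelʳ e f a (VecP.∷-injectiveʳ eq))

⊕-subtract : ∀ {m} (f b : Vec ℕ m) → zipWith ℕ._∸_ (f ⊕ b) b ≡ f
⊕-subtract []      []      = ≡.refl
⊕-subtract (x ∷ f) (y ∷ b) = ≡.cong₂ _∷_ (ℕP.m+n∸n≡m x y) (⊕-subtract f b)

-- Truncated subtraction gives the only possible quotient exponent, so testing that one candidate
-- decides divisibility of monomials.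
summand? : ∀ {m} (b e : Vec ℕ m) → Dec (∃ λ f → f ⊕ b ≡ e)
summand? b e with VecP.≡-dec ℕ._≟_ (zipWith ℕ._∸_ e b ⊕ b) e
... | yes eq = yes (_ , eq)
... | no neq = no λ { (f , ≡.refl) → neq (≡.cong (_⊕ b) (⊕-subtract f b)) }

≢⇒lookup≢ : ∀ {m} (a b : Vec ℕ m) → a ≢ b → ∃ λ i → lookup a i ≢ lookup b i
≢⇒lookup≢ []      []      a≢b = ⊥-elim (a≢b ≡.refl)
≢⇒lookup≢ (x ∷ a) (y ∷ b) a≢b with x ℕ.≟ y
... | no  x≢y    = Fin.zero , x≢y
... | yes ≡.refl with ≢⇒lookup≢ a b (a≢b ∘ ≡.cong (x ∷_))
...   | i , neq = Fin.suc i , neq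

module Polynomials {c ℓ} (K : Field c ℓ) (m : ℕ) where
  open Over K
  open Field K
  open Pairing commutativeRing
  open PairingSupport commutativeRing (_≟e_ {m})
  open RingProperties ring using (-1*x≈-x)
  open SetoidReasoning setoid

  pcoeff-pair : ∀ (p : Poly m) e → pcoeff p e ≈ pair p (δ _≟e_ e)
  pcoeff-pair []            e = refl
  pcoeff-pair ((k , f) ∷ p) e with f ≟e e
  ... | yes f≡e = trans (+-congˡ (pcoeff-pair p e)) (sym (pair-δ-≡ _≟e_ p f≡e))
  ... | no  f≢e = trans (pcoeff-pair p e) (sym (pair-δ-≢ _≟e_ p f≢e))

  -- A record around `_≈P_`, which unfolds to a family of equations in `K` and so would not
  -- determine the two polynomials.
  record _≋_ (p q : Poly m) : Set ℓ where
    constructor coefficientwise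
    field coefficients : p ≈P q
  open _≋_ public

  pair-equal⇒≋ : ∀ {p q : Poly m} → (∀ φ → pair p φ ≈ pair q φ) → p ≋ q
  pair-equal⇒≋ {p} {q} h = coefficientwise λ e → trans (pcoeff-pair p e) (trans (h _) (sym (pcoeff-pair q e)))

  -- Equal coefficients give equality only against delta functions; applying `pair-vanishes` to the
  -- difference extends it to every `φ`. With the converse, each ring law for polynomials becomes an
  -- identity of iterated pairings.
  ≋⇒pair-equal : ∀ {p q : Poly m} → p ≋ q → ∀ φ → pair p φ ≈ pair q φ
  ≋⇒pair-equal {p} {q} (coefficientwise p≈q) φ = GroupProperties.x∙y⁻¹≈ε⇒x≈y +-group _ _
    (trans (sym (pair-difference φ)) (pair-vanishes (p ++ (-P q)) difference-coefficient φ))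
    where
    pair-difference : ∀ ψ → pair (p ++ (-P q)) ψ ≈ pair p ψ - pair q ψ
    pair-difference ψ = trans (pair-++ p (-P q) ψ) (+-congˡ (pair-negate q ψ))
    difference-coefficient : ∀ e → pair (p ++ (-P q)) (δ _≟e_ e) ≈ 0#
    difference-coefficient e = begin
      pair (p ++ (-P q)) (δ _≟e_ e)              ≈⟨ pair-difference _ ⟩
      pair p (δ _≟e_ e) - pair q (δ _≟e_ e)      ≈⟨ +-cong (sym (pcoeff-pair p e)) (-‿cong (sym (pcoeff-pair q e))) ⟩
      pcoeff p e - pcoeff q e                    ≈⟨ +-congʳ (p≈q e) ⟩
      pcoeff q e - pcoeff q e                    ≈⟨ -‿inverseʳ _ ⟩
      0#                                         ∎

  private
    pair-*P : ∀ (p q : Poly m) φ → pair (p *P q) φ ≈ pair p (λ e → pair q (λ f → φ (e ⊕ f)))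
    pair-*P = pair-convolve _⊕_

    pair-1P : ∀ φ → pair (1P {m}) φ ≈ φ (replicate m 0)
    pair-1P φ = trans (+-identityʳ _) (*-identityˡ _)

    φ-cong : ∀ (φ : Exp m → Carrier) {e f} → e ≡ f → φ e ≈ φ f
    φ-cong φ eq = reflexive (≡.cong φ eq)

    *P-cong : ∀ {p p′ q q′ : Poly m} → p ≋ p′ → q ≋ q′ → (p *P q) ≋ (p′ *P q′)
    *P-cong {p} {p′} {q} {q′} p≈ q≈ = pair-equal⇒≋ λ φ → begin
      pair (p *P q) φ                                ≈⟨ pair-*P p q φ ⟩
      pair p (λ e → pair q (λ f → φ (e ⊕ f)))        ≈⟨ ≋⇒pair-equal p≈ _ ⟩
      pair p′ (λ e → pair q (λ f → φ (e ⊕ f)))       ≈⟨ pair-cong p′ (λ e → ≋⇒pair-equal q≈ _) ⟩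
      pair p′ (λ e → pair q′ (λ f → φ (e ⊕ f)))      ≈⟨ pair-*P p′ q′ φ ⟨
      pair (p′ *P q′) φ                              ∎

    *P-comm : ∀ (p q : Poly m) → (p *P q) ≋ (q *P p)
    *P-comm p q = pair-equal⇒≋ λ φ → begin
      pair (p *P q) φ                                ≈⟨ pair-*P p q φ ⟩
      pair p (λ e → pair q (λ f → φ (e ⊕ f)))        ≈⟨ pair-swap p q _ ⟩
      pair q (λ f → pair p (λ e → φ (e ⊕ f)))        ≈⟨ pair-cong q (λ f → pair-cong p (λ e →
                                                         φ-cong φ (VecP.zipWith-comm ℕP.+-comm e f))) ⟩
      pair q (λ f → pair p (λ e → φ (f ⊕ e)))        ≈⟨ pair-*P q p φ ⟨
      pair (q *P p) φ                                ∎

    *P-assoc : ∀ (p q r : Poly m) → ((p *P q) *P r) ≋ (p *P (q *P r))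
    *P-assoc p q r = pair-equal⇒≋ λ φ → begin
      pair ((p *P q) *P r) φ
        ≈⟨ trans (pair-*P (p *P q) r φ) (pair-*P p q _) ⟩
      pair p (λ e → pair q (λ f → pair r (λ g → φ ((e ⊕ f) ⊕ g))))
        ≈⟨ pair-cong p (λ e → pair-cong q (λ f → pair-cong r (λ g → φ-cong φ (VecP.zipWith-assoc ℕP.+-assoc e f g)))) ⟩
      pair p (λ e → pair q (λ f → pair r (λ g → φ (e ⊕ (f ⊕ g)))))
        ≈⟨ trans (pair-*P p (q *P r) φ) (pair-cong p (λ e → pair-*P q r _)) ⟨
      pair (p *P (q *P r)) φ ∎

    *P-identityˡ : ∀ (p : Poly m) → (1P *P p) ≋ p
    *P-identityˡ p = pair-equal⇒≋ λ φ → trans (pair-*P 1P p φ) (trans (pair-1P (λ e → pair p (λ f → φ (e ⊕ f))))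
      (pair-cong p (λ e → φ-cong φ (VecP.zipWith-identityˡ ℕP.+-identityˡ e))))

    *P-distribʳ : ∀ (r p q : Poly m) → ((p +P q) *P r) ≋ ((p *P r) +P (q *P r))
    *P-distribʳ r p q = pair-equal⇒≋ λ φ → begin
      pair ((p ++ q) *P r) φ
        ≈⟨ trans (pair-*P (p ++ q) r φ) (pair-++ p q _) ⟩
      pair p (λ e → pair r (λ f → φ (e ⊕ f))) + pair q (λ e → pair r (λ f → φ (e ⊕ f)))
        ≈⟨ trans (pair-++ (p *P r) (q *P r) φ) (+-cong (pair-*P p r φ) (pair-*P q r φ)) ⟨
      pair ((p *P r) +P (q *P r)) φ ∎

    +P-cong : ∀ {p p′ q q′ : Poly m} → p ≋ p′ → q ≋ q′ → (p +P q) ≋ (p′ +P q′)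
    +P-cong {p} {p′} {q} {q′} p≈ q≈ = pair-equal⇒≋ λ φ → trans (pair-++ p q φ)
      (trans (+-cong (≋⇒pair-equal p≈ φ) (≋⇒pair-equal q≈ φ)) (sym (pair-++ p′ q′ φ)))

    +P-comm : ∀ (p q : Poly m) → (p +P q) ≋ (q +P p)
    +P-comm p q = pair-equal⇒≋ λ φ → trans (pair-++ p q φ) (trans (+-comm _ _) (sym (pair-++ q p φ)))

    -P-cong : ∀ {p q : Poly m} → p ≋ q → (-P p) ≋ (-P q)
    -P-cong {p} {q} p≈q = pair-equal⇒≋ λ φ → trans (pair-negate p φ)
      (trans (-‿cong (≋⇒pair-equal p≈q φ)) (sym (pair-negate q φ)))

    -P-inverseʳ : ∀ (p : Poly m) → (p +P (-P p)) ≋ 0P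
    -P-inverseʳ p = pair-equal⇒≋ λ φ → trans (pair-++ p (-P p) φ)
      (trans (+-congˡ (pair-negate p φ)) (-‿inverseʳ _))

    ≡⇒≋ : ∀ {p q : Poly m} → p ≡ q → p ≋ q
    ≡⇒≋ ≡.refl = coefficientwise λ e → refl

    ≋-trans : ∀ {p q r : Poly m} → p ≋ q → q ≋ r → p ≋ r
    ≋-trans (coefficientwise p≈q) (coefficientwise q≈r) = coefficientwise λ e → trans (p≈q e) (q≈r e)

  polynomialRing : CommutativeRing c ℓ
  polynomialRing = record
    { Carrier = Poly m
    ; _≈_ = _≋_
    ; _+_ = _+P_
    ; _*_ = _*P_
    ; -_ = -P_
    ; 0# = 0P
    ; 1# = 1P
    ; isCommutativeRing = record
      { isRing = record
        { +-isAbelianGroup = record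
          { isGroup = record
            { isMonoid = record
              { isSemigroup = record
                { isMagma = record
                  { isEquivalence = record
                    { refl = ≡⇒≋ ≡.refl
                    ; sym = λ (coefficientwise p≈q) → coefficientwise λ e → sym (p≈q e)
                    ; trans = ≋-trans
                    }
                  ; ∙-cong = +P-cong
                  }
                ; assoc = λ p q r → ≡⇒≋ (ListP.++-assoc p q r)
                }
              ; identity = (λ p → ≡⇒≋ ≡.refl) , (λ p → ≡⇒≋ (ListP.++-identityʳ p))
              }
            ; inverse = (λ p → ≋-trans (+P-comm (-P p) p) (-P-inverseʳ p)) , -P-inverseʳ
            ; ⁻¹-cong = -P-cong
            }
          ; comm = +P-comm
          }
        ; *-cong = *P-cong
        ; *-assoc = *P-assoc
        ; *-identity = *P-identityˡ , (λ p → ≋-trans (*P-comm p 1P) (*P-identityˡ p))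
        ; distrib = (λ r p q → ≋-trans (*P-comm r (p +P q))
            (≋-trans (*P-distribʳ r p q) (+P-cong (*P-comm p r) (*P-comm q r)))) , *P-distribʳ
        }
      ; *-comm = *P-comm
      }
    }

  open Localization polynomialRing public using (Regular; regular-1; regular-*)

  mono-⊕ : ∀ e f → mono (e ⊕ f) ≋ (mono e *P mono f)
  mono-⊕ e f = pair-equal⇒≋ λ φ → +-congʳ (*-congʳ (sym (*-identityˡ 1#)))

  δ-shift : ∀ a e f → δ _≟e_ (e ⊕ a) (f ⊕ a) ≈ δ (_≟e_ {m}) e f
  δ-shift a e f = δ-cong _≟e_ _≟e_ (⊕-cancelʳ e f a) (≡.cong (_⊕ a))

  vanishes⇒≈0 : ∀ (p : Poly m) → (∀ e → pair p (δ _≟e_ e) ≈ 0#) → p ≋ 0P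
  vanishes⇒≈0 p h = coefficientwise λ e → trans (pcoeff-pair p e) (h e)

  -- Adding `a` is injective on exponents, so the coefficient of `p` at `e` reappears in the product
  -- at `e ⊕ a`.
  regular-mono : ∀ a → Regular (mono a)
  regular-mono a p p*xᵃ≈0 = vanishes⇒≈0 p λ e → begin
    pair p (δ _≟e_ e)
      ≈⟨ pair-cong p (λ f → trans (+-identityʳ _) (trans (*-identityˡ _) (δ-shift a e f))) ⟨
    pair p (λ f → pair (mono a) (λ g → δ _≟e_ (e ⊕ a) (f ⊕ g)))
      ≈⟨ pair-*P p (mono a) _ ⟨
    pair (p *P mono a) (δ _≟e_ (e ⊕ a))
      ≈⟨ ≋⇒pair-equal p*xᵃ≈0 _ ⟩
    0# ∎

  -- Multiplication by x^b moves every exponent further along coordinate i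
  -- than multiplication by x^a does, so the coefficients of p vanish by
  -- induction on that coordinate.
  shift-equal⇒vanishes : ∀ (p : Poly m) a b i → lookup a i ℕ.< lookup b i →
    (∀ φ → pair p (λ f → φ (f ⊕ b)) ≈ pair p (λ f → φ (f ⊕ a))) →
    ∀ e → pair p (δ _≟e_ e) ≈ 0#
  shift-equal⇒vanishes p a b i aᵢ<bᵢ shift e = go e (<-wellFounded (lookup e i))
    where
    go : ∀ e → Acc ℕ._<_ (lookup e i) → pair p (δ _≟e_ e) ≈ 0#
    go e (acc rs) = begin
      pair p (δ _≟e_ e)                          ≈⟨ pair-cong p (δ-shift a e) ⟨
      pair p (λ f → δ _≟e_ (e ⊕ a) (f ⊕ a))      ≈⟨ shift (δ _≟e_ (e ⊕ a)) ⟨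
      pair p (λ f → δ _≟e_ (e ⊕ a) (f ⊕ b))      ≈⟨ by-summand (summand? b (e ⊕ a)) ⟩
      0#                                         ∎
      where
      by-summand : Dec (∃ λ f → f ⊕ b ≡ e ⊕ a) → pair p (λ f → δ _≟e_ (e ⊕ a) (f ⊕ b)) ≈ 0#
      by-summand (no none) = trans (pair-cong p (λ f → δ-≢ _≟e_ λ eq → none (f , ≡.sym eq))) (pair-0 p)
      by-summand (yes (f , eq)) = begin
        pair p (λ g → δ _≟e_ (e ⊕ a) (g ⊕ b))  ≡⟨ ≡.cong (λ h → pair p (λ g → δ _≟e_ h (g ⊕ b))) eq ⟨
        pair p (λ g → δ _≟e_ (f ⊕ b) (g ⊕ b))  ≈⟨ pair-cong p (δ-shift b f) ⟩
        pair p (δ _≟e_ f)                      ≈⟨ go f (rs fᵢ<eᵢ) ⟩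
        0#                                     ∎
        where
        coordinate : lookup f i ℕ.+ lookup b i ≡ lookup e i ℕ.+ lookup a i
        coordinate = ≡.trans (≡.sym (VecP.lookup-zipWith ℕ._+_ i f b))
          (≡.trans (≡.cong (λ h → lookup h i) eq) (VecP.lookup-zipWith ℕ._+_ i e a))
        fᵢ<eᵢ : lookup f i ℕ.< lookup e i
        fᵢ<eᵢ = ℕP.+-cancelʳ-< (lookup b i) (lookup f i) (lookup e i)
          (≡.subst (ℕ._< lookup e i ℕ.+ lookup b i) (≡.sym coordinate) (ℕP.+-monoʳ-< (lookup e i) aᵢ<bᵢ))

  -- Picking a leading term of `p` would require deciding equality in `K`. Instead the hypothesis is
  -- read as p x^b = p x^a, and a coordinate in which `a` and `b` differ decides which of the two
  -- monomials shifts further.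
  regular-binomial : ∀ a b → a ≢ b → Regular (mono b +P (-P mono a))
  regular-binomial a b a≢b p p*d≈0 with ≢⇒lookup≢ a b a≢b
  ... | i , aᵢ≢bᵢ = vanishes⇒≈0 p (by-order (ℕP.<-cmp (lookup a i) (lookup b i)))
    where
    shifted : ∀ φ → pair p (λ f → φ (f ⊕ b)) ≈ pair p (λ f → φ (f ⊕ a))
    shifted φ = GroupProperties.x∙y⁻¹≈ε⇒x≈y +-group _ _ (begin
      pair p (λ f → φ (f ⊕ b)) - pair p (λ f → φ (f ⊕ a))
        ≈⟨ +-congˡ (trans (pair-*ˡ p _ (- 1#)) (-1*x≈-x _)) ⟨
      pair p (λ f → φ (f ⊕ b)) + pair p (λ f → - 1# * φ (f ⊕ a))
        ≈⟨ pair-+ p _ _ ⟨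
      pair p (λ f → φ (f ⊕ b) + - 1# * φ (f ⊕ a))
        ≈⟨ pair-cong p (λ f → +-cong (*-identityˡ _) (+-identityʳ _)) ⟨
      pair p (λ f → pair (mono b +P (-P mono a)) (λ g → φ (f ⊕ g)))
        ≈⟨ pair-*P p _ φ ⟨
      pair (p *P (mono b +P (-P mono a))) φ
        ≈⟨ ≋⇒pair-equal p*d≈0 φ ⟩
      0# ∎)
    by-order : Tri (lookup a i ℕ.< lookup b i) (lookup a i ≡ lookup b i) (lookup b i ℕ.< lookup a i) → ∀ e → pair p (δ _≟e_ e) ≈ 0#
    by-order (tri< aᵢ<bᵢ _ _) = shift-equal⇒vanishes p a b i aᵢ<bᵢ shifted
    by-order (tri≈ _ aᵢ≡bᵢ _) = ⊥-elim (aᵢ≢bᵢ aᵢ≡bᵢ)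
    by-order (tri> _ _ bᵢ<aᵢ) = shift-equal⇒vanishes p b a i bᵢ<aᵢ (λ φ → sym (shifted φ))

-- The weights q_u in K(q)

tabulate-+ : ∀ {m} (f g : Fin m → ℕ) → Vec.tabulate (λ i → f i ℕ.+ g i) ≡ Vec.tabulate f ⊕ Vec.tabulate g
tabulate-+ {zero}  f g = ≡.refl
tabulate-+ {suc m} f g = ≡.cong (f Fin.zero ℕ.+ g Fin.zero Vec.∷_) (tabulate-+ (f ∘ Fin.suc) (g ∘ Fin.suc))

tabulate-constant : ∀ {m} {f : Fin m → ℕ} {k} → (∀ i → f i ≡ k) → Vec.tabulate f ≡ replicate m k
tabulate-constant {zero}  h = ≡.refl
tabulate-constant {suc m} h = ≡.cong₂ Vec._∷_ (h Fin.zero) (tabulate-constant (h ∘ Fin.suc))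

module Weights {c ℓ} (K : Field c ℓ) (m : ℕ) where
  open Over K
  open Polynomials K m
  open Localization polynomialRing hiding (Regular; regular-1; regular-*)
  private module P = CommutativeRing polynomialRing
  open NaturalCoefficients P.commutativeSemiring using (solve; _:=_; _:+_; _:*_; con)

  count-∷ : ∀ {n} (i x : Fin n) u → count i (x ∷ u) ≡ count i [ x ] ℕ.+ count i u
  count-∷ i x u with x Fin.≟ i
  ... | yes _ = ≡.refl
  ... | no  _ = ≡.refl

  count-∉ : ∀ {n} {x : Fin n} {u} → x ∉ u → count x u ≡ 0
  count-∉ {x = x} x∉u = ≡.cong length (ListP.filter-none (Fin._≟ x) (All.tabulate λ { y∈u ≡.refl → x∉u y∈u }))

  count-head : ∀ {n} (x : Fin n) u → count x (x ∷ u) ≡ suc (count x u)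
  count-head x u = ≡.cong length (ListP.filter-accept (Fin._≟ x) ≡.refl)

  count-unique : ∀ {n} {x : Fin n} {u} → Unique u → x ∈ u → count x u ≡ 1
  count-unique {u = x ∷ u} uniq (here ≡.refl) = ≡.trans (count-head x u) (≡.cong suc (count-∉ (unique-∷⇒∉ uniq)))
  count-unique {x = x} {u = y ∷ u} uniq@(_ ∷ uniq-u) (there x∈u) = ≡.trans
    (≡.cong length (ListP.filter-reject (Fin._≟ x) {x = y} λ { ≡.refl → unique-∷⇒∉ uniq x∈u }))
    (count-unique uniq-u x∈u)

  private Letters = List (Fin (suc m))

  expNum-∷ : ∀ x (u : Letters) → expNum (x ∷ u) ≡ expNum [ x ] ⊕ expNum u
  expNum-∷ x u = ≡.trans (VecP.tabulate-cong λ i → count-∷ (inject₁ i) x u)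
    (tabulate-+ (λ i → count (inject₁ i) [ x ]) (λ i → count (inject₁ i) u))

  expDen-∷ : ∀ x (u : Letters) → expDen (x ∷ u) ≡ expDen [ x ] ⊕ expDen u
  expDen-∷ x u = ≡.trans (≡.cong (replicate m) (count-∷ (fromℕ m) x u))
    (≡.sym (VecP.zipWith-replicate ℕ._+_ (count (fromℕ m) [ x ]) (count (fromℕ m) u)))

  -- Because q_n is the inverse of q_1⋯q_{n-1}, the exponent of q_i in q_u is the number of i in `u`
  -- minus the number of n. Hence q_u = 1 exactly when all letters occur equally often.
  count-constant⇒exp≡ : ∀ (u : Letters) {k} → (∀ x → count x u ≡ k) → expNum u ≡ expDen u
  count-constant⇒exp≡ u h = tabulate-constant λ i → ≡.trans (h (inject₁ i)) (≡.sym (h (fromℕ m)))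

  exp≡⇒count-constant : ∀ (u : Letters) → expNum u ≡ expDen u → ∀ x → count x u ≡ count (fromℕ m) u
  exp≡⇒count-constant u eq x with view x
  ... | ‵fromℕ         = ≡.refl
  ... | ‵inj₁ {i = i} _ = ≡.trans (≡.sym (VecP.lookup∘tabulate (λ i → count (inject₁ i) u) i))
    (≡.trans (≡.cong (λ v → Vec.lookup v i) eq) (VecP.lookup-replicate i _))

  proper⇒exp≢ : ∀ (u : Letters) z → u ≢ [] → z ∉ u → expNum u ≢ expDen u
  proper⇒exp≢ []      z u≢[] z∉u eq = u≢[] ≡.refl
  proper⇒exp≢ (x ∷ u) z u≢[] z∉u eq
    with () ← ≡.trans (≡.sym (count-head x u)) (≡.trans (exp≡⇒count-constant (x ∷ u) eq x)
      (≡.trans (≡.sym (exp≡⇒count-constant (x ∷ u) eq z)) (count-∉ z∉u)))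

  -- Over an arbitrary field K without decidable equality, cross-multiplication
  -- is transitive only for denominators that are known to be cancellable.
  record RegularFunction : Set (c ⊔ ℓ) where
    constructor regularFunction
    field
      ratFun      : RatFun m
      regularDens : All (Regular ∘ proj₁) (dens ratFun)
  open RegularFunction public

  regular-prodP : ∀ {ds : List (NZPoly m)} → All (Regular ∘ proj₁) ds → Regular (prodP ds)
  regular-prodP []           = regular-1
  regular-prodP (reg ∷ regs) = regular-* reg (regular-prodP regs)

  toFraction : RegularFunction → Fraction
  toFraction (regularFunction r regs) = fraction (num r) (den r) (regular-prodP regs)

  record _≅_ (x y : RegularFunction) : Set ℓ where
    constructor crossMultiplied
    field crossMultiply : toFraction x ≃ toFraction y
  open _≅_ public

  prodP-++ : ∀ (ds es : List (NZPoly m)) → prodP (ds ++ es) ≋ (prodP ds *P prodP es)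
  prodP-++ []       es = P.sym (P.*-identityˡ (prodP es))
  prodP-++ (d ∷ ds) es = P.trans (P.*-congˡ {proj₁ d} (prodP-++ ds es)) (P.sym (P.*-assoc (proj₁ d) (prodP ds) (prodP es)))

  rawRegularRing : RawRing (c ⊔ ℓ) ℓ
  rawRegularRing = record
    { Carrier = RegularFunction
    ; _≈_ = _≅_
    ; _+_ = λ (regularFunction r regs) (regularFunction s regs′) → regularFunction (r +R s) (AllP.++⁺ regs regs′)
    ; _*_ = λ (regularFunction r regs) (regularFunction s regs′) → regularFunction (r *R s) (AllP.++⁺ regs regs′)
    ; -_ = λ (regularFunction r regs) → regularFunction (-R r) regs
    ; 0# = regularFunction 0R []
    ; 1# = regularFunction 1R []
    }

  -- Carries the ring laws over from the localization. Equality is defined through `toFraction`, so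
  -- injectivity is immediate; the operations differ only in that one side concatenates lists of
  -- denominators and the other multiplies their products.
  toFraction-isRingMonomorphism : IsRingMonomorphism rawRegularRing (CommutativeRing.rawRing localization) toFraction
  toFraction-isRingMonomorphism = record
    { isRingHomomorphism = record
      { isSemiringHomomorphism = record
        { isNearSemiringHomomorphism = record
          { +-isMonoidHomomorphism = record
            { isMagmaHomomorphism = record
              { isRelHomomorphism = record { cong = crossMultiply }
              ; homo = λ x y → P.*-congˡ {num (ratFun x +R ratFun y)} (P.sym (prodP-++ (dens (ratFun x)) (dens (ratFun y))))
              }
            ; ε-homo = P.refl
            }
          ; *-homo = λ x y → P.*-congˡ {num (ratFun x *R ratFun y)} (P.sym (prodP-++ (dens (ratFun x)) (dens (ratFun y))))
          }
        ; 1#-homo = P.refl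
        }
      ; -‿homo = λ x → P.refl
      }
    ; injective = crossMultiplied
    }

  regularRing : CommutativeRing (c ⊔ ℓ) ℓ
  regularRing = record
    { isCommutativeRing = RingMonomorphism.isCommutativeRing toFraction-isRingMonomorphism
        (CommutativeRing.isCommutativeRing localization) }

  open CommutativeRing regularRing using (_≈_; _+_; _*_; -_; 1#)

  weightQ : Letters → RegularFunction
  weightQ u = regularFunction (qProd u) (regular-mono (expDen u) ∷ [])

  recip-regular : ∀ (u : Letters) → All (Regular ∘ proj₁) (dens (recipOneMinus u))
  recip-regular u with expNum u ≟e expDen u
  ... | yes _  = []
  ... | no a≢b = regular-binomial (expNum u) (expDen u) a≢b ∷ []

  recip : Letters → RegularFunction
  recip u = regularFunction (recipOneMinus u) (recip-regular u)

  recip-inverse : ∀ u z → u ≢ [] → z ∉ u → recip u * (1# + - weightQ u) ≈ 1#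
  recip-inverse u z u≢[] z∉u = crossMultiplied cross
    where
    cross : (num (recipOneMinus u *R (1R +R (-R qProd u))) *P 1P) ≋ (1P *P den (recipOneMinus u *R (1R +R (-R qProd u))))
    cross with expNum u ≟e expDen u
    ... | yes eq = ⊥-elim (proper⇒exp≢ u z u≢[] z∉u eq)
    -- Here `x` is x^b and `n` is -x^a, where q_u = x^a / x^b; the identity is x^b/(x^b - x^a) · (1
    -- - x^a/x^b) = 1 with denominators multiplied out.
    ... | no _   = solve 2 (λ x n → (x :* (con 1 :* (x :* con 1) :+ n :* con 1)) :* con 1
                                 := con 1 :* ((x :+ n) :* (x :* con 1))) P.refl
                     (mono (expDen u)) (-P mono (expNum u))

  weightQ-∷ : ∀ x u → weightQ (x ∷ u) ≈ weightQ [ x ] * weightQ u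
  weightQ-∷ x u = crossMultiplied (begin
    mono (expNum (x ∷ u)) *P (mono dx *P (mono du *P 1P))
      ≈⟨ P.*-congʳ {mono dx *P (mono du *P 1P)} (split (expNum-∷ x u)) ⟩
    (mono nx *P mono nu) *P (mono dx *P (mono du *P 1P))
      ≈⟨ solve 3 (λ n a b → n :* (a :* (b :* con 1)) := n :* ((a :* b) :* con 1)) P.refl (mono nx *P mono nu) (mono dx) (mono du) ⟩
    (mono nx *P mono nu) *P ((mono dx *P mono du) *P 1P)
      ≈⟨ P.*-congˡ {mono nx *P mono nu} (P.*-congʳ {1P} (split (expDen-∷ x u))) ⟨
    (mono nx *P mono nu) *P (mono (expDen (x ∷ u)) *P 1P) ∎)
    where
    open SetoidReasoning P.setoid
    nx = expNum [ x ]
    nu = expNum u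
    dx = expDen [ x ]
    du = expDen u
    split : ∀ {e f g} → e ≡ f ⊕ g → mono e ≋ (mono f *P mono g)
    split ≡.refl = mono-⊕ _ _

  weightQ-balanced : ∀ u → expNum u ≡ expDen u → weightQ u ≈ 1#
  weightQ-balanced u eq = crossMultiplied
    (P.trans (solve 1 (λ x → x :* con 1 := con 1 :* (x :* con 1)) P.refl (mono (expNum u)))
      (P.reflexive (≡.cong (λ e → 1P *P (mono e *P 1P)) eq)))

  weightQ-[] : weightQ [] ≈ 1#
  weightQ-[] = weightQ-balanced [] (count-constant⇒exp≡ [] (λ _ → ≡.refl))

  allFin-unique : Unique (allFin (suc m))
  allFin-unique = UniqueP.allFin⁺ (suc m)

  -- The relation q_1⋯q_n = 1, from which the weight of every complete word is obtained by
  -- rearrangement.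
  weightQ-allFin : weightQ (allFin (suc m)) ≈ 1#
  weightQ-allFin = weightQ-balanced (allFin (suc m)) (count-constant⇒exp≡ (allFin (suc m)) (λ x → count-unique allFin-unique (∈-allFin x)))

  prefixWeights : PrefixWeights regularRing m
  prefixWeights = record
    { Q = weightQ
    ; r = recip
    ; Q-[] = weightQ-[]
    ; Q-∷ = weightQ-∷
    ; r-inverse = recip-inverse
    }

-- e_n(q) as a combination of brackets

module _ {c ℓ} (K : Field c ℓ) (m : ℕ) where
  open Over K
  open Weights K m
  open CommutativeRing regularRing
  open ScalarIdentities regularRing using (weight)
  open KlyachkoCoefficients regularRing m prefixWeights
  open ShuffleSum {A = Fin (suc m)} regularRing
  open RightNormed regularRing (Fin._≟_ {suc m})
  open Pairing regularRing
  open SetoidReasoning setoid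

  private
    Letters = List (Fin (suc m))

  ratFun-product : ∀ {a} {A : Set a} (f : A → RegularFunction) (g : A → RatFun m) → (∀ x → ratFun (f x) ≡ g x) →
    ∀ xs → ratFun (product (map f xs)) ≡ prodR (map g xs)
  ratFun-product f g h []       = ≡.refl
  ratFun-product f g h (x ∷ xs) = ≡.cong₂ _*R_ (h x) (ratFun-product f g h xs)

  ratFun-coefficient : ∀ σ → ratFun (coefficient σ) ≡ coeffE σ
  ratFun-coefficient σ = ≡.cong₂ _*R_
    (ratFun-product (descentFactor σ) _ (λ j → ratFun-weight (descentAt σ j)) (map suc (upTo m)))
    (ratFun-product (reciprocalFactor σ) _ (λ i → ≡.refl) (map suc (upTo m)))
    where
    ratFun-weight : ∀ d {x} → ratFun (weight d x) ≡ (if d then ratFun x else 1R)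
    ratFun-weight true  = ≡.refl
    ratFun-weight false = ≡.refl

  private
    -- Any letter could play this role; the first makes `allFin (suc m)` literally `z ∷ others`, the
    -- shape that `expansion-coefficient` asks for.
    z : Fin (suc m)
    z = Fin.zero
    others : Letters
    others = tabulate Fin.suc

  open LieExpansion regularRing coefficient using (expansion; expansion-coefficient)

  allFin-coefficient-shuffle : ∀ u v → u ++ z ∷ reverse v ↭ allFin (suc m) →
    coefficient (u ++ z ∷ reverse v) ≈ sign v * shuffleSum u v (λ s → coefficient (s ∷ʳ z))
  allFin-coefficient-shuffle u v w↭ = coefficient-shuffle u z v
    (unique-↭ (↭-sym w↭) allFin-unique) (trans (Q-↭ w↭) weightQ-allFin)
    (≡.trans (↭-length w↭) (ListP.length-tabulate (λ (i : Fin (suc m)) → i)))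

  toFA : List (RegularFunction × Letters) → FA m
  toFA = map (λ t → (ratFun (proj₁ t) , proj₂ t))

  toFA-scale : ∀ k p → toFA (map (λ t → (k * proj₁ t , proj₂ t)) p) ≡ ratFun k ·A toFA p
  toFA-scale k []      = ≡.refl
  toFA-scale k (t ∷ p) = ≡.cong (_ ∷_) (toFA-scale k p)

  toFA-convolve : ∀ p q → toFA (convolve _++_ p q) ≡ toFA p *A toFA q
  toFA-convolve []            q = ≡.refl
  toFA-convolve ((k , u) ∷ p) q = ≡.trans
    (ListP.map-++ _ (map (λ t → (k * proj₁ t , u ++ proj₂ t)) q) (convolve _++_ p q))
    (≡.cong₂ _++_ (row q) (toFA-convolve p q))
    where
    row : ∀ q → toFA (map (λ t → (k * proj₁ t , u ++ proj₂ t)) q) ≡ map (λ t → (ratFun k *R proj₁ t , u ++ proj₂ t)) (toFA q)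
    row []      = ≡.refl
    row (t ∷ q) = ≡.cong (_ ∷_) (row q)

  toFA-bracket : ∀ p q → toFA (bracket p q) ≡ ⟦ toFA p , toFA q ⟧
  toFA-bracket p q = ≡.trans
    (ListP.map-++ _ (convolve _++_ p q) _)
    (≡.cong₂ _++_ (toFA-convolve p q)
      (≡.trans (toFA-scale (- 1#) (convolve _++_ q p)) (≡.cong ((-R 1R) ·A_) (toFA-convolve q p))))

  rightNormed-isLie : ∀ x t → IsLie (toFA (rightNormed x t))
  rightNormed-isLie x []      = gen x
  rightNormed-isLie x (y ∷ t) = ≡.subst IsLie (≡.sym (toFA-bracket (letter y) (rightNormed x t)))
    (brk (gen y) (rightNormed-isLie x t))

  expansion-isLie : ∀ x ts → IsLie (toFA (expansion x ts))
  expansion-isLie x []       = zer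
  expansion-isLie x (t ∷ ts) = ≡.subst IsLie
    (≡.sym (≡.trans (ListP.map-++ _ (map _ (rightNormed x t)) (expansion x ts))
      (≡.cong (_++ toFA (expansion x ts)) (toFA-scale (coefficient (t ∷ʳ x)) (rightNormed x t)))))
    (add (scl (ratFun (coefficient (t ∷ʳ x))) (rightNormed-isLie x t)) (expansion-isLie x ts))

  -- Cross-multiplication on all of `RatFun m` is not known to be transitive. The coefficient is
  -- therefore exhibited as the `ratFun` of a regular function `r`, and only `r` takes part in
  -- chains of equations.
  acoeff-pair : ∀ p w → ∃ λ r → (ratFun r ≡ acoeff (toFA p) w) × r ≈ pair p (δ _≟*_ w)
  acoeff-pair []            w = 0# , ≡.refl , refl
  acoeff-pair ((k , v) ∷ p) w with acoeff-pair p w | v ≟w w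
  ... | r , eq , r≈ | yes v≡w = k + r , ≡.cong (ratFun k +R_) eq ,
    trans (+-congˡ {k} r≈) (sym (pair-δ-≡ _≟*_ {k} p v≡w))
  ... | r , eq , r≈ | no  v≢w = r , eq , trans r≈ (sym (pair-δ-≢ _≟*_ {k} p v≢w))

  pair-equal⇒≈A : ∀ p q → (∀ w → pair p (δ _≟*_ w) ≈ pair q (δ _≟*_ w)) → toFA p ≈A toFA q
  pair-equal⇒≈A p q h w with acoeff-pair p w | acoeff-pair q w
  ... | r , r≡ , r≈ | s , s≡ , s≈ = ≡.subst₂ _≈R_ r≡ s≡
    (Polynomials.coefficients (crossMultiply (trans r≈ (trans (h w) (sym s≈)))))

  toFA-eN : toFA (weighted coefficient (Sn (suc m))) ≡ eN m
  toFA-eN = ≡.trans (≡.sym (ListP.map-∘ (Sn (suc m))))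
    (ListP.map-cong (λ σ → ≡.cong (_, σ) (ratFun-coefficient σ)) (Sn (suc m)))

  eN-isLie : IsLie (eN m)
  eN-isLie = resp (expansion-isLie z (perms others))
    (≡.subst (toFA (expansion z (perms others)) ≈A_) toFA-eN
      (pair-equal⇒≈A (expansion z (perms others)) (weighted coefficient (Sn (suc m)))
        (expansion-coefficient allFin-unique allFin-coefficient-shuffle)))

theorem1p7 : ∀ {c ℓ} (K : Field c ℓ) → CharZero K → (m : ℕ) →
    Over.IsLie K (Over.eN K m)
theorem1p7 K _ m = eN-isLie K m
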